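{- Let $n=p_1^{r_1}p_2^{r_2}\cdots p_k^{r_k}$, where $k\ge1$, $p_1,\ldots,p_k$ are distinct primes and $r_1\ge r_2\ge\cdots\ge r_k\ge1$. If $n$ is not prime, then $$F(G(n))=\sum_{\substack{i_1<i_2<\cdots<i_s\\ \emptyset\ne\{i_1,\ldots,i_s\}\subseteq\{1,\ldots,k\}}} r_{i_1}r_{i_2}\cdots r_{i_s}\,x_{i_1}x_{i_2}\cdots x_{i_s}.$$ If $n$ is prime, then $F(G(n))=1$.
   Context: For an integer $n\ge2$, $G(n)$ is the simple undirected graph whose vertex set is the set of divisors of $n$ greater than $1$, two distinct vertices $a,b$ adjacent iff $\gcd(a,b)>1$. A clique is a set of pairwise adjacent vertices; a set $S$ of cliques of $G$ is a total clique covering if every vertex lies in some member of $S$ and every edge has both endpoints in some member of $S$; $\theta_t(G)$ is the minimum size of a total clique covering. The code $\sigma(G)$ of a graph $G$ with $m$ vertices and $s\ge0$ isolated vertices: let $k'=\theta_t(G)-s$; for each total clique covering $S=\{C_1,\ldots,C_{s+k'}\}$ with $|S|=\theta_t(G)$ (where $C_1,\ldots,C_s$ are the singletons of the isolated vertices) and each bijective assignment of the first $k'$ primes to $C_{s+1},\ldots,C_{s+k'}$, label each isolated vertex by $1$ and each other vertex $v$ by the product of primes assigned to the cliques among $C_{s+1},\ldots,C_{s+k'}$ containing $v$, and list the labels in non-decreasing order; $\sigma[S]$ is the lexicographically least sequence so obtained from $S$, and $\sigma(G)$ is the lexicographically least among all $\sigma[S]$ with $|S|=\theta_t(G)$. The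 normal polynomial representation $F(G)\in\mathbb{Z}_{\ge0}[x_1,x_2,\ldots]$ is $\sum_{\lambda} m(\lambda)$, summed over the entries $\lambda$ of $\sigma(G)$ (with multiplicity), where $m(1)=1$ and $m(q_{j_1}q_{j_2}\cdots q_{j_r})=x_{j_1}x_{j_2}\cdots x_{j_r}$ for distinct indices $j_1,\ldots,j_r$, $q_j$ denoting the $j$-th prime. -}

module Defs where

open import Data.Bool.Base using (if_then_else_)
import Data.Bool.Properties as Bool
open import Data.Fin.Base using (Fin)
import Data.Fin.Properties as Fin
open import Data.Fin.Subset using (Subset; inside; outside; _∈_; ⁅_⁆; _∪_)
open import Data.Fin.Subset.Properties using (_∈?_; x∈⁅x⁆; x∈⁅y⁆⇒x≡y; x∈p∪q⁻; x∈p∪q⁺; ⊆-antisym)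
open import Data.List.Base using (List; []; _∷_; _++_; map; filter; foldr; length; lookup; zip; upTo; allFin; cartesianProductWith)
import Data.List.Properties as List
open import Data.List.Membership.Propositional using (lose; find) renaming (_∈_ to _∈ₗ_)
open import Data.List.Membership.Propositional.Properties using (∈-∃++; ∈-map⁺; ∈-map⁻; ∈-++⁺ˡ; ∈-++⁺ʳ; ∈-filter⁺; ∈-filter⁻; ∈-cartesianProductWith⁺)
open import Data.List.Relation.Binary.Lex.NonStrict using (Lex-≤; ≤-decTotalOrder)
open import Data.List.Relation.Binary.Permutation.Propositional using (_↭_; ↭-refl; ↭-sym; ↭-trans; ↭-reflexive; prep; ↭⇒↭ₛ)
open import Data.List.Relation.Binary.Permutation.Propositional.Properties using (shift; ∈-resp-↭; All-resp-↭; Any-resp-↭; ↭-length)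
import Data.List.Relation.Binary.Permutation.Setoid.Properties as PermSetoid
import Data.List.Relation.Binary.Pointwise as Pointwise
open import Data.List.Relation.Unary.All as All using (All; []; _∷_)
import Data.List.Relation.Unary.All.Properties as All
open import Data.List.Relation.Unary.AllPairs using ([]; _∷_)
open import Data.List.Relation.Unary.Any as Any using (Any; here; there)
open import Data.List.Relation.Unary.Sorted.TotalOrder.Properties using (↗↭↗⇒≋)
open import Data.List.Relation.Unary.Unique.Propositional using (Unique)
import Data.List.Relation.Unary.Unique.Propositional.Properties as Unique
import Data.List.Relation.Unary.Unique.DecPropositional as DecUnique
open import Data.Nat.Base using (ℕ; zero; suc; _*_; _∸_; _≤_; _<_; _!)
open import Data.Nat.Divisibility using (_∣_; _∣?_; ∣-trans; ∣1⇒≡1; ∣m+n∣m⇒∣n; m∣m*n; m≤n⇒m!∣n!)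
open import Data.Nat.GCD using (gcd; gcd-comm)
open import Data.Nat.ListAction using (sum; product)
open import Data.Nat.Primality using (Prime; prime?; ¬prime[0]; ¬prime[1])
open import Data.Nat.Primality.Factorisation using (factorise; PrimeFactorisation)
import Data.Nat.Properties as ℕ
open import Data.Product.Base using (∃; _×_; _,_; proj₁; proj₂)
open import Data.Sum.Base using (_⊎_; inj₁; inj₂; [_,_]′)
open import Data.Vec.Base using ([]; _∷_)
import Data.Vec.Properties as Vec
open import Function.Base using (_∘_; case_of_)
open import Relation.Binary.Bundles using (DecTotalOrder)
open import Relation.Binary.Definitions using (DecidableEquality)
open import Relation.Binary.PropositionalEquality using (_≡_; _≢_; refl; sym; trans; cong; subst; setoid)
open import Relation.Nullary using (¬_; Dec; yes; no; does; contradiction)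
open import Relation.Nullary.Decidable using (map′; _×-dec_; _→-dec_; ¬?)
open import Relation.Unary using (Decidable)

open import Data.List.Sort ℕ.≤-decTotalOrder using (sort; sort-↭; sort-↗)

IsMinimum : (ℕ → Set) → ℕ → Set
IsMinimum P n = P n × (∀ m → P m → n ≤ m)

abstract
  minimum : {P : ℕ → Set} → Decidable P → ∃ P → ∃ (IsMinimum P)
  minimum {P} P? (n , pn) with search (suc n)
    where
    search : ∀ b → ∃ (IsMinimum P) ⊎ (∀ m → m < b → ¬ P m)
    search zero    = inj₂ λ _ ()
    search (suc b) with search b
    ... | inj₁ found = inj₁ found
    ... | inj₂ none with P? b
    ...   | yes pb = inj₁ (b , pb , λ m pm → ℕ.≮⇒≥ λ m<b → none m m<b pm)
    ...   | no ¬pb = inj₂ λ m m<1+b pm →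
                [ (λ m<b → none m m<b pm) , (λ { refl → ¬pb pm }) ]′ (ℕ.m<1+n⇒m<n∨m≡n m<1+b)
  ... | inj₁ found = found
  ... | inj₂ none  = contradiction pn (none n ℕ.≤-refl)

_≤ₗₑₓ_ : List ℕ → List ℕ → Set
_≤ₗₑₓ_ = Lex-≤ _≡_ _≤_

IsLexLeast : {A : Set} → (A → Set) → (A → List ℕ) → List ℕ → Set
IsLexLeast Q f τ = (∃ λ a → Q a × τ ≡ f a) × (∀ a → Q a → τ ≤ₗₑₓ f a)

private
  module Lex = DecTotalOrder (≤-decTotalOrder ℕ.≤-decTotalOrder)

abstract
  lexLeast : {A : Set} {Q : A → Set} (f : A → List ℕ) (xs : List A) →
             Decidable Q → (∀ a → Q a → a ∈ₗ xs) → ∃ Q → ∃ (IsLexLeast Q f)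
  lexLeast {A} {Q} f xs Q? complete (a₀ , q₀) with go xs
    where
    go : ∀ ys → ∃ λ a → Q a × (∀ b → b ∈ₗ ys → Q b → f a ≤ₗₑₓ f b)
    go []       = a₀ , q₀ , λ _ ()
    go (y ∷ ys) with go ys | Q? y
    ... | a , qa , least | no ¬qy = a , qa , λ
            { b (here refl) qb → contradiction qb ¬qy
            ; b (there b∈)  qb → least b b∈ qb }
    ... | a , qa , least | yes qy with Lex.total (f a) (f y)
    ...   | inj₁ a≤y = a , qa , λ
            { b (here refl) _  → a≤y
            ; b (there b∈)  qb → least b b∈ qb }
    ...   | inj₂ y≤a = y , qy , λ
            { b (here refl) _  → Lex.refl
            ; b (there b∈)  qb → Lex.trans y≤a (least b b∈ qb) }
  ... | a , qa , least = f a , (a , qa , refl) , λ b qb → least b (complete b qb) qb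

allSubsets : ∀ n → List (Subset n)
allSubsets zero    = [] ∷ []
allSubsets (suc n) = map (outside ∷_) (allSubsets n) ++ map (inside ∷_) (allSubsets n)

elements : ∀ {n} → Subset n → List (Fin n)
elements {n} I = filter (_∈? I) (allFin n)

allSubsets-complete : ∀ {n} (I : Subset n) → I ∈ₗ allSubsets n
allSubsets-complete []            = here refl
allSubsets-complete (outside ∷ I) = ∈-++⁺ˡ (∈-map⁺ _ (allSubsets-complete I))
allSubsets-complete (inside ∷ I)  = ∈-++⁺ʳ _ (∈-map⁺ _ (allSubsets-complete I))

allSubsets-unique : ∀ n → Unique (allSubsets n)
allSubsets-unique zero    = [] ∷ []
allSubsets-unique (suc n) = Unique.++⁺
  (Unique.map⁺ Vec.∷-injectiveʳ (allSubsets-unique n))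
  (Unique.map⁺ Vec.∷-injectiveʳ (allSubsets-unique n))
  λ { (∈₁ , ∈₂) → case (∈-map⁻ _ ∈₁ , ∈-map⁻ _ ∈₂) of λ { ((_ , _ , refl) , (_ , _ , ())) } }

listsOfLength : {A : Set} → ℕ → List A → List (List A)
listsOfLength zero    xs = [] ∷ []
listsOfLength (suc t) xs = cartesianProductWith _∷_ xs (listsOfLength t xs)

listsOfLength-complete : {A : Set} (xs ys : List A) → All (_∈ₗ xs) ys → ys ∈ₗ listsOfLength (length ys) xs
listsOfLength-complete xs []       []         = here refl
listsOfLength-complete xs (y ∷ ys) (y∈ ∷ ys⊆) =
  ∈-cartesianProductWith⁺ _∷_ y∈ (listsOfLength-complete xs ys ys⊆)

infix 4 _↭?_
_↭?_ : (xs ys : List ℕ) → Dec (xs ↭ ys)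
xs ↭? ys = map′
  (λ eq → ↭-trans (↭-sym (sort-↭ xs)) (↭-trans (↭-reflexive eq) (sort-↭ ys)))
  (λ xs↭ys → Pointwise.Pointwise-≡⇒≡ (↗↭↗⇒≋ ℕ.≤-totalOrder (sort-↗ xs) (sort-↗ ys)
    (↭⇒↭ₛ (↭-trans (sort-↭ xs) (↭-trans xs↭ys (↭-sym (sort-↭ ys)))))))
  (List.≡-dec ℕ._≟_ (sort xs) (sort ys))

PrimeAbove : ℕ → ℕ → Set
PrimeAbove n p = n < p × Prime p

primeAbove? : ∀ n → Decidable (PrimeAbove n)
primeAbove? n p = (n ℕ.<? p) ×-dec prime? p

abstract
  euclid : ∀ n → ∃ (PrimeAbove n)
  euclid n = go (factorise (suc (n !)))
    where
    p∣p! : ∀ {p} → Prime p → p ∣ p !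
    p∣p! {zero}  pr = contradiction pr ¬prime[0]
    p∣p! {suc p} pr = m∣m*n (p !)

    go : PrimeFactorisation (suc (n !)) → ∃ (PrimeAbove n)
    go record { factors = [] ; isFactorisation = eq } =
      contradiction (subst (1 ≤_) (ℕ.suc-injective eq) (ℕ.1≤n! n)) λ ()
    go record { factors = p ∷ ps ; isFactorisation = eq ; factorsPrime = pr ∷ _ } =
      p , ℕ.≰⇒> (λ p≤n → ¬prime[1] (subst Prime (∣1⇒≡1 (∣m+n∣m⇒∣n
            (subst (p ∣_) (trans (sym eq) (ℕ.+-comm 1 (n !))) (m∣m*n (product ps)))
            (∣-trans (p∣p! pr) (m≤n⇒m!∣n! p≤n)))) pr)) , pr

  nextPrime-exists : ∀ n → ∃ (IsMinimum (PrimeAbove n))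
  nextPrime-exists n = minimum (primeAbove? n) (euclid n)

nextPrime : ℕ → ℕ
nextPrime n = proj₁ (nextPrime-exists n)

nextPrime-minimum : ∀ n → IsMinimum (PrimeAbove n) (nextPrime n)
nextPrime-minimum n = proj₂ (nextPrime-exists n)

-- Indices are shifted by one: nthPrime j is q_{j+1} (and X j below is x_{j+1}).
nthPrime : ℕ → ℕ
nthPrime zero    = 2
nthPrime (suc j) = nextPrime (nthPrime j)

firstPrimes : ℕ → List ℕ
firstPrimes k = map nthPrime (upTo k)

-- A list of variable indices stands for the product of these variables, so
-- two lists denote the same monomial iff they are permutations of each other.
Monomial : Set
Monomial = List ℕ

-- A formal sum of terms; monomials may repeat and coefficients may vanish,
-- and equality is equality of all coefficients.
Polynomial : Set
Polynomial = List (ℕ × Monomial)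

coefficient : Polynomial → Monomial → ℕ
coefficient P μ = sum (map proj₁ (filter (λ term → proj₂ term ↭? μ) P))

infix 4 _≈_
_≈_ : Polynomial → Polynomial → Set
P ≈ Q = ∀ μ → coefficient P μ ≡ coefficient Q μ

const : ℕ → Polynomial
const c = (c , []) ∷ []

X : ℕ → Polynomial
X j = (1 , j ∷ []) ∷ []

infixl 6 _⊕_
_⊕_ : Polynomial → Polynomial → Polynomial
_⊕_ = _++_

infixl 7 _⊗_
_⊗_ : Polynomial → Polynomial → Polynomial
_⊗_ = cartesianProductWith λ (c , μ) (d , ν) → c * d , μ ++ ν

sumₚ : List Polynomial → Polynomial
sumₚ = foldr _⊕_ []

productₚ : List Polynomial → Polynomial
productₚ = foldr _⊗_ (const 1)

record Graph : Set₁ where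
  field
    order  : ℕ
    Adj    : Fin order → Fin order → Set
    adj?   : ∀ u v → Dec (Adj u v)
    symm   : ∀ {u v} → Adj u v → Adj v u
    irrefl : ∀ {v} → ¬ Adj v v

module _ (G : Graph) where
  open Graph G

  Isolated : Fin order → Set
  Isolated v = ∀ u → ¬ Adj v u

  isolated? : Decidable Isolated
  isolated? v = Fin.all? λ u → ¬? (adj? v u)

  isolatedVertices : List (Fin order)
  isolatedVertices = filter isolated? (allFin order)

  IsClique : Subset order → Set
  IsClique C = ∀ u v → u ∈ C → v ∈ C → u ≢ v → Adj u v

  isClique? : Decidable IsClique
  isClique? C = Fin.all? λ u → Fin.all? λ v →
    (u ∈? C) →-dec ((v ∈? C) →-dec (¬? (u Fin.≟ v) →-dec adj? u v))

  -- Sets of cliques are duplicate-free lists.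
  record IsTotalCliqueCovering (S : List (Subset order)) : Set where
    constructor mkCovering
    field
      unique       : Unique S
      cliques      : All IsClique S
      coversVertex : ∀ v → Any (v ∈_) S
      coversEdge   : ∀ u v → Adj u v → Any (λ C → u ∈ C × v ∈ C) S

  HasCoveringOfSize : ℕ → Set
  HasCoveringOfSize t = ∃ λ S → IsTotalCliqueCovering S × length S ≡ t

  private
    _≟ₛ_ : DecidableEquality (Subset order)
    _≟ₛ_ = Vec.≡-dec Bool._≟_

  isTotalCliqueCovering? : Decidable IsTotalCliqueCovering
  isTotalCliqueCovering? S = map′
    (λ (a , b , c , d) → mkCovering a b c d)
    (λ (mkCovering a b c d) → a , b , c , d)
    (DecUnique.unique? _≟ₛ_ S
      ×-dec All.all? isClique? S
      ×-dec Fin.all? (λ v → Any.any? (v ∈?_) S)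
      ×-dec Fin.all? (λ u → Fin.all? λ v →
              adj? u v →-dec Any.any? (λ C → (u ∈? C) ×-dec (v ∈? C)) S))

  private
    complete : (S : List (Subset order)) → S ∈ₗ listsOfLength (length S) (allSubsets order)
    complete S = listsOfLength-complete _ S (All.universal allSubsets-complete S)

    hasCoveringOfSize? : Decidable HasCoveringOfSize
    hasCoveringOfSize? t = map′
      (λ any → let S , _ , q = find any in S , q)
      (λ { (S , cov , refl) → lose (complete S) (cov , refl) })
      (Any.any? (λ S → isTotalCliqueCovering? S ×-dec (length S ℕ.≟ t))
                (listsOfLength t (allSubsets order)))

    allCliques : List (Subset order)
    allCliques = filter isClique? (allSubsets order)

    allCliques-covering : IsTotalCliqueCovering allCliques
    allCliques-covering = mkCovering
      (Unique.filter⁺ isClique? (allSubsets-unique order))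
      (All.all-filter isClique? (allSubsets order))
      (λ v → lose (∈-filter⁺ isClique? (allSubsets-complete ⁅ v ⁆) (singleton v)) (x∈⁅x⁆ v))
      (λ u v uv → lose (∈-filter⁺ isClique? (allSubsets-complete (⁅ u ⁆ ∪ ⁅ v ⁆)) (pair uv))
                       (x∈p∪q⁺ (inj₁ (x∈⁅x⁆ u)) , x∈p∪q⁺ {p = ⁅ u ⁆} (inj₂ (x∈⁅x⁆ v))))
      where
      singleton : ∀ v → IsClique ⁅ v ⁆
      singleton v a b a∈ b∈ a≢b =
        contradiction (trans (x∈⁅y⁆⇒x≡y v a∈) (sym (x∈⁅y⁆⇒x≡y v b∈))) a≢b

      pair : ∀ {u v} → Adj u v → IsClique (⁅ u ⁆ ∪ ⁅ v ⁆)
      pair {u} {v} uv a b a∈ b∈ a≢b with x∈p∪q⁻ ⁅ u ⁆ ⁅ v ⁆ a∈ | x∈p∪q⁻ ⁅ u ⁆ ⁅ v ⁆ b∈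
      ... | inj₁ a∈u | inj₁ b∈u = singleton u a b a∈u b∈u a≢b
      ... | inj₂ a∈v | inj₂ b∈v = singleton v a b a∈v b∈v a≢b
      ... | inj₁ a∈u | inj₂ b∈v rewrite x∈⁅y⁆⇒x≡y u a∈u | x∈⁅y⁆⇒x≡y v b∈v = uv
      ... | inj₂ a∈v | inj₁ b∈u rewrite x∈⁅y⁆⇒x≡y v a∈v | x∈⁅y⁆⇒x≡y u b∈u = symm uv

  abstract
    θₜ-exists : ∃ (IsMinimum HasCoveringOfSize)
    θₜ-exists = minimum hasCoveringOfSize? (_ , allCliques , allCliques-covering , refl)

  θₜ : ℕ
  θₜ = proj₁ θₜ-exists

  θₜ-minimum : IsMinimum HasCoveringOfSize θₜ
  θₜ-minimum = proj₂ θₜ-exists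

  isolatedSingletons : List (Subset order)
  isolatedSingletons = map ⁅_⁆ isolatedVertices

  -- A minimum total clique covering S, listed with the singletons of the
  -- isolated vertices first, is determined by the list R of its other members.
  IsMinimumCovering : List (Subset order) → Set
  IsMinimumCovering R =
    IsTotalCliqueCovering (isolatedSingletons ++ R) × length (isolatedSingletons ++ R) ≡ θₜ

  k′ : ℕ
  k′ = θₜ ∸ length isolatedVertices

  -- A bijective assignment of the first k′ primes to the members of R:
  -- the i-th entry of ps is assigned to the i-th entry of R.
  IsAssignment : List ℕ → Set
  IsAssignment ps = ps ↭ firstPrimes k′

  label : List (Subset order) → List ℕ → Fin order → ℕ
  label R ps v =
    if does (isolated? v)
    then 1
    else product (map proj₁ (filter (λ pC → v ∈? proj₂ pC) (zip ps R)))

  labels : List (Subset order) → List ℕ → List ℕ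
  labels R ps = sort (map (label R ps) (allFin order))

  abstract
    σ[]-exists : ∀ R → ∃ (IsLexLeast IsAssignment (labels R))
    σ[]-exists R = lexLeast (labels R) (listsOfLength (length (firstPrimes k′)) (firstPrimes k′))
      (_↭? firstPrimes k′)
      (λ ps ps↭ → subst (λ l → ps ∈ₗ listsOfLength l (firstPrimes k′)) (↭-length ps↭)
                    (listsOfLength-complete _ ps (All.tabulate (∈-resp-↭ ps↭))))
      (firstPrimes k′ , ↭-refl)

  -- σ[S] for S = isolatedSingletons ++ R.
  σ[_] : List (Subset order) → List ℕ
  σ[ R ] = proj₁ (σ[]-exists R)

  σ[]-lexLeast : ∀ R → IsLexLeast IsAssignment (labels R) σ[ R ]
  σ[]-lexLeast R = proj₂ (σ[]-exists R)

  private
    extract : {A : Set} (xs ys : List A) → Unique xs → (∀ {x} → x ∈ₗ xs → x ∈ₗ ys) →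
              ∃ λ zs → ys ↭ xs ++ zs
    extract []       ys _        _  = ys , ↭-refl
    extract (x ∷ xs) ys (x∉ ∷ u) xs⊆ with ∈-∃++ (xs⊆ (here refl))
    ... | as , bs , refl with extract xs (as ++ bs) u (λ x′∈ →
            case ∈-resp-↭ (shift x as bs) (xs⊆ (there x′∈)) of λ
              { (here refl) → contradiction refl (All.lookup x∉ x′∈)
              ; (there p)   → p })
    ...   | zs , p = zs , ↭-trans (shift x as bs) (prep x p)

    isolatedSingletons-unique : Unique isolatedSingletons
    isolatedSingletons-unique = Unique.map⁺
      (λ {u} {v} eq → x∈⁅y⁆⇒x≡y v (subst (u ∈_) eq (x∈⁅x⁆ u)))
      (Unique.filter⁺ isolated? (Unique.allFin⁺ order))

    isolatedSingletons⊆ : ∀ {S} → IsTotalCliqueCovering S → ∀ {C} → C ∈ₗ isolatedSingletons → C ∈ₗ S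
    isolatedSingletons⊆ {S} (mkCovering _ cl cv _) C∈ with ∈-map⁻ ⁅_⁆ C∈
    ... | v , v∈ , refl with find (cv v)
    ...   | D , D∈S , v∈D = subst (_∈ₗ S) (sym ⁅v⁆≡D) D∈S
      where
      iso : Isolated v
      iso = proj₂ (∈-filter⁻ isolated? {xs = allFin order} v∈)

      only : ∀ {u} → u ∈ D → u ∈ ⁅ v ⁆
      only {u} u∈D with v Fin.≟ u
      ... | yes refl = x∈⁅x⁆ v
      ... | no v≢u   = contradiction (All.lookup cl D∈S v u v∈D u∈D v≢u) (iso u)

      ⁅v⁆≡D : ⁅ v ⁆ ≡ D
      ⁅v⁆≡D = ⊆-antisym (λ {u} u∈ → subst (_∈ D) (sym (x∈⁅y⁆⇒x≡y v u∈)) v∈D) only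

    covering-resp-↭ : ∀ {S T} → S ↭ T → IsTotalCliqueCovering S → IsTotalCliqueCovering T
    covering-resp-↭ p (mkCovering un cl cv ce) = mkCovering
      (PermSetoid.Unique-resp-↭ (setoid _) (↭⇒↭ₛ p) un)
      (All-resp-↭ p cl)
      (λ v → Any-resp-↭ p (cv v))
      (λ u v uv → Any-resp-↭ p (ce u v uv))

    minimumCovering-exists : ∃ IsMinimumCovering
    minimumCovering-exists with θₜ-minimum
    ... | (S , cov , len) , _
        with extract isolatedSingletons S isolatedSingletons-unique (isolatedSingletons⊆ cov)
    ...   | R , p = R , covering-resp-↭ p cov , trans (sym (↭-length p)) len

    minimumCovering-length : ∀ R → IsMinimumCovering R → length R ≡ θₜ ∸ length isolatedSingletons
    minimumCovering-length R (_ , len) = sym (trans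
      (cong (_∸ length isolatedSingletons) (trans (sym len) (List.length-++ isolatedSingletons)))
      (ℕ.m+n∸m≡n (length isolatedSingletons) (length R)))

  abstract
    σ-exists : ∃ (IsLexLeast IsMinimumCovering σ[_])
    σ-exists = lexLeast σ[_] (listsOfLength (θₜ ∸ length isolatedSingletons) (allSubsets order))
      (λ R → isTotalCliqueCovering? (isolatedSingletons ++ R)
             ×-dec (length (isolatedSingletons ++ R) ℕ.≟ θₜ))
      (λ R min → subst (λ l → R ∈ₗ listsOfLength l (allSubsets order))
                   (minimumCovering-length R min) (complete R))
      minimumCovering-exists

  σ : List ℕ
  σ = proj₁ σ-exists

  σ-lexLeast : IsLexLeast IsMinimumCovering σ[_] σ
  σ-lexLeast = proj₂ σ-exists

-- Meaningful for squarefree l ≥ 1, as all labels are. The bound on j loses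
-- nothing, since nthPrime j > j.
monomial : ℕ → Polynomial
monomial l = productₚ (map X (filter (λ j → nthPrime j ∣? l) (upTo l)))

F : Graph → Polynomial
F G = sumₚ (map monomial (σ G))

divisors>1 : ℕ → List ℕ
divisors>1 n = filter (λ d → (1 ℕ.<? d) ×-dec (d ∣? n)) (upTo (suc n))

-- The vertices are the positions in the duplicate-free list divisors>1 n.
-- Only n ≥ 2 is of interest.
divisorGraph : ℕ → Graph
divisorGraph n = record
  { order  = length (divisors>1 n)
  ; Adj    = λ u v → u ≢ v × 1 < gcd (divisor u) (divisor v)
  ; adj?   = λ u v → ¬? (u Fin.≟ v) ×-dec (1 ℕ.<? gcd (divisor u) (divisor v))
  ; symm   = λ {u} {v} (u≢v , 1<g) →
      u≢v ∘ sym , subst (1 <_) (gcd-comm (divisor u) (divisor v)) 1<g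
  ; irrefl = λ (v≢v , _) → v≢v refl
  }
  where
  divisor : Fin (length (divisors>1 n)) → ℕ
  divisor = lookup (divisors>1 n)

{-# OPTIONS --safe #-}
-- The primes p_1, …, p_k are pairwise non-adjacent, so a minimum total clique
-- covering consists of k cliques with one of these primes in each, and covering
-- the edges at p_i forces the i-th clique to be the set of all multiples of p_i.
-- Hence the labelling depends only on the assignment of q_1, …, q_k to the p_i,
-- and a product of the q's at the indices in a set I occurs once for every choice
-- of positive exponents at I, i.e. (product of the r_i over I) times. Two
-- assignments that first differ at q_j give the same number of labels of each
-- value below q_j, while the number of labels q_j is the exponent bound assigned
-- to q_j; so the lexicographic minimum gives non-increasing exponents.
module Submission where

open import Defs
open import Data.Bool.Base using (true; false; if_then_else_)
open import Data.Fin.Base using (Fin; toℕ) renaming (zero to fzero; suc to fsuc; _≤_ to _≤ᶠ_)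
open import Data.Fin.Properties using (toℕ-injective)
import Data.Fin.Properties as Fin
open import Data.Fin.Subset using (Subset; inside; outside; _∈_; ⊥; ⁅_⁆)
open import Data.Fin.Subset.Properties using (_∈?_; nonempty?; Empty-unique; ∉⊥; ⊆-antisym)
open import Data.List.Base using (List; []; _∷_; _++_; map; filter; length; allFin; tabulate; upTo; applyUpTo; lookup; zip)
open import Data.List.Membership.Propositional using (find) renaming (_∈_ to _∈ₗ_)
open import Data.List.Membership.Propositional.Properties using (∈-++⁺ˡ; ∈-++⁺ʳ; ∈-++⁻; ∈-map⁺; ∈-map⁻; ∈-filter⁺; ∈-filter⁻; ∈-upTo⁺; ∈-lookup; ∈-allFin; ∈-∃++)
open import Data.List.Membership.Propositional.Properties.WithK using (unique∧set⇒bag)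
open import Data.List.Properties using (map-++; map-∘; map-cong; map-tabulate; ∷-injective; filter-accept; filter-reject; map-cong-local; map-upTo; filter-++; filter-none; map-id; tabulate-lookup; length-map; length-upTo; length-tabulate; ++-identityʳ)
open import Data.List.Relation.Binary.BagAndSetEquality using (∼bag⇒↭)
open import Data.List.Relation.Binary.Lex.NonStrict using (base; this; next; ≤-antisymmetric)
open import Data.List.Relation.Binary.Permutation.Propositional using (_↭_; refl; prep; swap; trans; ↭-sym; ↭-refl; ↭-trans; ↭-reflexive; ↭⇒↭ₛ)
open import Data.List.Relation.Binary.Permutation.Propositional.Properties using (shift; drop-∷; ∈-resp-↭; map⁺; ↭-length; ↭-map-inv)
import Data.List.Relation.Binary.Permutation.Setoid.Properties as PermSetoid
open import Data.List.Relation.Binary.Pointwise using (Pointwise-≡⇒≡)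
open import Data.List.Relation.Unary.All as All using (All; []; _∷_)
import Data.List.Relation.Unary.All.Properties as All
open import Data.List.Relation.Unary.AllPairs as AllPairs using (AllPairs; []; _∷_)
import Data.List.Relation.Unary.AllPairs.Properties as AllPairs
open import Data.List.Relation.Unary.Any as Any using (here; there; Any)
import Data.List.Relation.Unary.Any.Properties as Any
open import Data.List.Relation.Unary.Sorted.TotalOrder.Properties using (Sorted⇒AllPairs)
open import Data.List.Relation.Unary.Unique.Propositional using (Unique)
import Data.List.Relation.Unary.Unique.Propositional.Properties as Unique
open import Data.Nat.Base
open import Data.Nat.Coprimality using (Coprime; coprime-divisor)
open import Data.Nat.Divisibility
open import Data.Nat.GCD using (gcd; gcd[m,n]∣m; gcd[m,n]∣n; gcd-greatest; gcd[m,n]≢0)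
open import Data.Nat.ListAction using (sum; product)
open import Data.Nat.ListAction.Properties using (sum-++; product-↭; product≢0; sum-↭; ∈⇒∣product)
open import Data.Nat.Primality using (Prime; euclidsLemma; prime⇒irreducible; prime⇒nonZero; prime⇒nonTrivial; ¬prime[1]; prime[2]; productOfPrimes≢0)
open import Data.Nat.Primality.Factorisation using (factorisationHasAllPrimeFactors)
open import Data.Nat.Properties
open import Data.Nat.Tactic.RingSolver using (solve-∀)
open import Data.Product.Base using (_×_; _,_; proj₁; proj₂; ∃; map₂)
open import Data.Sum.Base using (_⊎_; inj₁; inj₂)
open import Data.Unit.Base using (tt)
open import Data.Vec.Base using () renaming (_∷_ to _∷ᵥ_)
import Data.Vec.Base as Vec
import Data.Vec.Properties as Vec
open import Function.Base using (_∘_; id)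
open import Function.Bundles using (mk⇔)
open import Function.Definitions using (Injective)
open import Relation.Binary.Definitions using (tri<; tri≈; tri>)
open import Relation.Binary.PropositionalEquality as ≡ using (_≡_; _≢_; refl; sym; cong; cong₂; subst; module ≡-Reasoning)
open import Relation.Nullary using (yes; no; does; contradiction; ¬_; Dec)
open import Relation.Nullary.Decidable using (dec-true; dec-false; _×-dec_; does-⇔)
open import Data.List.Sort ≤-decTotalOrder using (sort-↭; sort-↗)

-- No list of labels is ever computed. It is seen only through the sums `sumOver h` over its
-- entries: with `h` an indicator `δ v` they decide the lexicographic comparison, with `h` a
-- coefficient of `monomial` they give `F`. In the non-prime case every such sum has the closed form
-- `S`. That form also counts the empty choice, which stands for the divisor 1; since 1 is not a
-- vertex, a term `h 1` is carried on the side of the labels and cancelled at the end. The obstacle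
-- is that equal exponents give several optimal assignments, so the assignment attaining `σ` cannot
-- be identified. What is compared instead are lists of pairs (assigned prime, exponent), which tied
-- assignments share. Minimum coverings may also list their cliques in any order; since `S` ignores
-- the order of the pairs, the competing assignment can be written in the clique order on which `σ`
-- is attained.

private variable
  A B : Set

-- Weighted sums over subcollections

sumOver : (A → ℕ) → List A → ℕ
sumOver h xs = sum (map h xs)

sumOver-++ : (h : A → ℕ) (xs ys : List A) → sumOver h (xs ++ ys) ≡ sumOver h xs + sumOver h ys
sumOver-++ h xs ys = ≡.trans (cong sum (map-++ h xs ys)) (sum-++ (map h xs) (map h ys))

sumOver-map : (h : B → ℕ) (f : A → B) (xs : List A) → sumOver h (map f xs) ≡ sumOver (h ∘ f) xs
sumOver-map h f xs = cong sum (sym (map-∘ xs))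

sumOver-* : (c : ℕ) (h : A → ℕ) (xs : List A) → sumOver (λ x → c * h x) xs ≡ c * sumOver h xs
sumOver-* c h []       = sym (*-zeroʳ c)
sumOver-* c h (x ∷ xs) = ≡.trans (cong (c * h x +_) (sumOver-* c h xs)) (sym (*-distribˡ-+ c (h x) _))

sumOver-cong : {g h : A → ℕ} → (∀ x → g x ≡ h x) → ∀ xs → sumOver g xs ≡ sumOver h xs
sumOver-cong g≗h xs = cong sum (map-cong g≗h xs)

-- A collection Z of pairs (w , m) stands for elements w occurring in m
-- colours; S h Z sums h over all ways to choose a subcollection and a colour
-- for each of its members.
S : (List A → ℕ) → List (A × ℕ) → ℕ
S h []            = h []
S h ((w , m) ∷ Z) = S h Z + m * S (h ∘ (w ∷_)) Z

S-cong : {g h : List A → ℕ} → (∀ xs → g xs ≡ h xs) → ∀ Z → S g Z ≡ S h Z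
S-cong eq []            = eq []
S-cong eq ((w , m) ∷ Z) = cong₂ (λ a b → a + m * b) (S-cong eq Z) (S-cong (eq ∘ (w ∷_)) Z)

-- Swapping two adjacent pairs exchanges the terms that pick just one of them; only the term that
-- picks both meets `h` at a reordered list, and this is where `inv` enters.
S-resp-↭ : {h : List A → ℕ} → (∀ {xs ys} → xs ↭ ys → h xs ≡ h ys) →
           ∀ {Y Z} → Y ↭ Z → S h Y ≡ S h Z
S-resp-↭ inv refl = refl
S-resp-↭ inv (prep (w , m) Y↭Z) =
  cong₂ (λ a b → a + m * b) (S-resp-↭ inv Y↭Z) (S-resp-↭ (inv ∘ prep w) Y↭Z)
S-resp-↭ {h = h} inv (swap {Y} {Z} (v , l) (w , m) Y↭Z) = begin
  S h Y + m * S (h ∘ (w ∷_)) Y + l * (S (h ∘ (v ∷_)) Y + m * S (h ∘ (v ∷_) ∘ (w ∷_)) Y)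
    ≡⟨ cong₂ (λ a b → a + m * S (h ∘ (w ∷_)) Y + l * b)
         (S-resp-↭ inv Y↭Z)
         (cong₂ (λ a b → a + m * b) (S-resp-↭ (inv ∘ prep v) Y↭Z)
           (≡.trans (S-resp-↭ (inv ∘ prep v ∘ prep w) Y↭Z)
                    (S-cong (λ _ → inv (swap v w ↭-refl)) Z))) ⟩
  S h Z + m * S (h ∘ (w ∷_)) Y + l * (S (h ∘ (v ∷_)) Z + m * S (h ∘ (w ∷_) ∘ (v ∷_)) Z)
    ≡⟨ cong (λ a → S h Z + m * a + _) (S-resp-↭ (inv ∘ prep w) Y↭Z) ⟩
  S h Z + m * S (h ∘ (w ∷_)) Z + l * (S (h ∘ (v ∷_)) Z + m * S (h ∘ (w ∷_) ∘ (v ∷_)) Z)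
    ≡⟨ rearrange (S h Z) m _ l _ _ ⟩
  S h Z + l * S (h ∘ (v ∷_)) Z + m * (S (h ∘ (w ∷_)) Z + l * S (h ∘ (w ∷_) ∘ (v ∷_)) Z) ∎
  where
  open ≡-Reasoning
  rearrange : ∀ a m b l c d → a + m * b + l * (c + m * d) ≡ a + l * c + m * (b + l * d)
  rearrange = solve-∀
S-resp-↭ inv (trans p q) = ≡.trans (S-resp-↭ inv p) (S-resp-↭ inv q)

S-zero : {P : A → Set} {h : List A → ℕ} → (∀ xs → All P xs → h xs ≡ 0) →
         ∀ {Z} → All (P ∘ proj₁) Z → S h Z ≡ 0
S-zero h≡0 []        = h≡0 [] []
S-zero h≡0 {(w , m) ∷ Z} (pw ∷ ps) = cong₂ _+_
  (S-zero h≡0 ps)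
  (≡.trans (cong (m *_) (S-zero (λ xs pxs → h≡0 (w ∷ xs) (pw ∷ pxs)) ps)) (*-zeroʳ m))

S-[] : {P : A → Set} {h : List A → ℕ} → (∀ x xs → P x → All P xs → h (x ∷ xs) ≡ 0) →
       ∀ {Z} → All (P ∘ proj₁) Z → S h Z ≡ h []
S-[] h≡0 []                    = refl
S-[] {h = h} h≡0 {(w , m) ∷ Z} (pw ∷ ps) = ≡.trans
  (cong₂ _+_ (S-[] h≡0 ps)
    (≡.trans (cong (m *_) (S-zero (λ xs pxs → h≡0 w xs pw pxs) ps)) (*-zeroʳ m)))
  (+-identityʳ _)

-- Expansion of `S` over index sets

allFin-suc : ∀ k → allFin (suc k) ≡ fzero ∷ map fsuc (allFin k)
allFin-suc k = cong (fzero ∷_) (sym (map-tabulate (λ i → i) fsuc))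

filter-∈-map-suc : ∀ {k} b (I : Subset k) (is : List (Fin k)) →
                   filter (_∈? (b ∷ᵥ I)) (map fsuc is) ≡ map fsuc (filter (_∈? I) is)
filter-∈-map-suc b I []       = refl
filter-∈-map-suc b I (i ∷ is) with does (i ∈? I)
... | true  = cong (fsuc i ∷_) (filter-∈-map-suc b I is)
... | false = filter-∈-map-suc b I is

elements-inside : ∀ {k} (I : Subset k) → elements (inside ∷ᵥ I) ≡ fzero ∷ map fsuc (elements I)
elements-inside {k} I = ≡.trans (cong (filter (_∈? (inside ∷ᵥ I))) (allFin-suc k))
  (cong (fzero ∷_) (filter-∈-map-suc inside I (allFin k)))

elements-outside : ∀ {k} (I : Subset k) → elements (outside ∷ᵥ I) ≡ map fsuc (elements I)
elements-outside {k} I = ≡.trans (cong (filter (_∈? (outside ∷ᵥ I))) (allFin-suc k))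
  (filter-∈-map-suc outside I (allFin k))

-- The two summands of `S` at the head pair are the subsets without and with `fzero`, the two halves
-- of `allSubsets (suc k)`. This turns the recursion that fits divisors into the sum that the
-- theorem displays.
S-subsets : (h : List A → ℕ) → ∀ k (g : Fin k → A) (r : Fin k → ℕ) →
  S h (map (λ i → g i , r i) (allFin k)) ≡
  sumOver (λ I → product (map r (elements I)) * h (map g (elements I))) (allSubsets k)
S-subsets h zero    g r = sym (≡.trans (+-identityʳ _) (+-identityʳ _))
S-subsets {A} h (suc k) g r = begin
  S h (map (λ i → g i , r i) (allFin (suc k)))
    ≡⟨ cong (λ is → S h (map (λ i → g i , r i) is)) (allFin-suc k) ⟩
  S h ((g fzero , r fzero) ∷ map (λ i → g i , r i) (map fsuc (allFin k)))
    ≡⟨ cong (λ Z → S h ((g fzero , r fzero) ∷ Z)) (map-∘ (allFin k)) ⟨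
  S h ((g fzero , r fzero) ∷ map (λ i → g (fsuc i) , r (fsuc i)) (allFin k))
    ≡⟨ cong₂ (λ a b → a + r fzero * b)
         (S-subsets h k (g ∘ fsuc) (r ∘ fsuc))
         (S-subsets (h ∘ (g fzero ∷_)) k (g ∘ fsuc) (r ∘ fsuc)) ⟩
  sumOver (t h) Is + r fzero * sumOver (t (h ∘ (g fzero ∷_))) Is
    ≡⟨ cong₂ _+_ (sumOver-cong out Is)
         (≡.trans (sym (sumOver-* (r fzero) _ Is)) (sumOver-cong ins Is)) ⟩
  sumOver (T ∘ (outside ∷ᵥ_)) Is + sumOver (T ∘ (inside ∷ᵥ_)) Is
    ≡⟨ cong₂ _+_ (sumOver-map T _ Is) (sumOver-map T _ Is) ⟨
  sumOver T (map (outside ∷ᵥ_) Is) + sumOver T (map (inside ∷ᵥ_) Is)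
    ≡⟨ sumOver-++ T (map (outside ∷ᵥ_) Is) _ ⟨
  sumOver T (allSubsets (suc k)) ∎
  where
  open ≡-Reasoning
  Is = allSubsets k
  t : (List A → ℕ) → Subset k → ℕ
  t h I = product (map (r ∘ fsuc) (elements I)) * h (map (g ∘ fsuc) (elements I))
  T : Subset (suc k) → ℕ
  T I = product (map r (elements I)) * h (map g (elements I))

  T′ : List (Fin (suc k)) → ℕ
  T′ is = product (map r is) * h (map g is)

  out : ∀ I → t h I ≡ T (outside ∷ᵥ I)
  out I = ≡.trans
    (cong₂ (λ a b → product a * h b) (map-∘ (elements I)) (map-∘ (elements I)))
    (cong T′ (sym (elements-outside I)))

  ins : ∀ I → r fzero * t (h ∘ (g fzero ∷_)) I ≡ T (inside ∷ᵥ I)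
  ins I = ≡.trans (sym (*-assoc (r fzero) _ _)) (≡.trans
    (cong₂ (λ a b → r fzero * product a * h (g fzero ∷ b)) (map-∘ (elements I)) (map-∘ (elements I)))
    (cong T′ (sym (elements-inside I))))

-- Lexicographic comparison by counting

δ : ℕ → ℕ → ℕ
δ v x = if does (v ≟ x) then 1 else 0

δ-refl : ∀ v → δ v v ≡ 1
δ-refl v = cong (λ b → if b then 1 else 0) (dec-true (v ≟ v) refl)

δ-≢ : ∀ {v x} → v ≢ x → δ v x ≡ 0
δ-≢ {v} {x} v≢x = cong (λ b → if b then 1 else 0) (dec-false (v ≟ x) v≢x)

count : ℕ → List ℕ → ℕ
count v = sumOver (δ v)

count-∉ : ∀ {v xs} → All (v <_) xs → count v xs ≡ 0
count-∉ []          = refl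
count-∉ (v<x ∷ all) = cong₂ _+_ (δ-≢ (<⇒≢ v<x)) (count-∉ all)

-- At the first difference, an entry `y` of `ys` below the entry `x` of `xs` is impossible. As `xs`
-- is sorted, `x` and everything after it exceed `y`: if `y < q`, this contradicts the equal counts
-- of `y`; if `q ≤ y`, no copy of `q` is left in `xs`, against the strict inequality at `q`.
≤ₗₑₓ-by-count : ∀ q {xs ys} → AllPairs _≤_ xs → length xs ≡ length ys →
  (∀ v → v < q → count v xs ≡ count v ys) → count q ys < count q xs → xs ≤ₗₑₓ ys
≤ₗₑₓ-by-count q {[]}     {[]}     _ _ _ _ = base tt
≤ₗₑₓ-by-count q {x ∷ xs} {y ∷ ys} (x≤ ∷ sorted) len below at with <-cmp x y
... | tri< x<y _ _ = this (<⇒≤ x<y , <⇒≢ x<y)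
... | tri≈ _ refl _ = next refl (≤ₗₑₓ-by-count q sorted (suc-injective len)
        (λ v v<q → +-cancelˡ-≡ (δ v x) _ _ (below v v<q)) (+-cancelˡ-< (δ q x) _ _ at))
... | tri> _ _ y<x with y <? q
...   | no y≮q = contradiction (subst (count q (y ∷ ys) <_)
          (count-∉ (All.map (<-≤-trans (≤-<-trans (≮⇒≥ y≮q) y<x)) (≤-refl ∷ x≤))) at) λ ()
...   | yes y<q = contradiction (≡.trans (sym (≡.trans (below y y<q) (cong (_+ count y ys) (δ-refl y))))
          (count-∉ (All.map (<-≤-trans y<x) (≤-refl ∷ x≤)))) λ ()

-- With assigned primes as weights and exponents as colours, this is the number of labels equal to
-- `v`, plus one for the divisor 1 when `v` is 1.
multiplicity : ℕ → List (ℕ × ℕ) → ℕ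
multiplicity v = S (δ v ∘ product)

Weights>1 : List (ℕ × ℕ) → Set
Weights>1 = All ((1 <_) ∘ proj₁)

product≥1 : ∀ {xs} → All (1 <_) xs → 1 ≤ product xs
product≥1 []         = ≤-refl
product≥1 (1<x ∷ ps) = *-mono-≤ (<⇒≤ 1<x) (product≥1 ps)

-- Any choice that includes `w` has a product of at least `w`, which is already too large.
multiplicity-cons : ∀ {v w m Z} → v < w → Weights>1 Z → multiplicity v ((w , m) ∷ Z) ≡ multiplicity v Z
multiplicity-cons {v} {w} {m} {Z} v<w ws = ≡.trans
  (cong (λ s → multiplicity v Z + m * s) (S-zero
    (λ xs 1<xs → δ-≢ (<⇒≢ (<-≤-trans v<w (m≤m*n w (product xs) {{>-nonZero (product≥1 1<xs)}})))) ws))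
  (≡.trans (cong (multiplicity v Z +_) (*-zeroʳ m)) (+-identityʳ _))

multiplicity-++ : ∀ {v Y Z} → All ((v <_) ∘ proj₁) Y → Weights>1 Y → Weights>1 Z →
                  multiplicity v (Y ++ Z) ≡ multiplicity v Z
multiplicity-++ []        []       ws = refl
multiplicity-++ {Y = (_ , m) ∷ _} (v< ∷ vs) (_ ∷ us) ws = ≡.trans (multiplicity-cons {m = m} v< (All.++⁺ us ws)) (multiplicity-++ vs us ws)

-- A choice that includes `w` has product `w` only if it includes nothing else, and `w` comes in `m`
-- colours. The exponent attached to a prime is thus visible as a count.
multiplicity-head : ∀ {w m Z} → 1 < w → Weights>1 Z → multiplicity w ((w , m) ∷ Z) ≡ multiplicity w Z + m
multiplicity-head {w} {m} {Z} 1<w ws = cong (multiplicity w Z +_) (≡.trans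
  (cong (m *_) (≡.trans (S-[] vanish ws) (≡.trans (cong (δ w) (*-identityʳ w)) (δ-refl w))))
  (*-identityʳ m))
  where
  vanish : ∀ x xs → 1 < x → All (1 <_) xs → δ w (w * (x * product xs)) ≡ 0
  vanish x xs 1<x 1<xs = δ-≢ (<⇒≢ (m<m*n w _ {{>-nonZero (<-trans z<s 1<w)}}
    (<-≤-trans 1<x (m≤m*n x (product xs) {{>-nonZero (product≥1 1<xs)}}))))

product-inv : ∀ {h : ℕ → ℕ} {xs ys} → xs ↭ ys → h (product xs) ≡ h (product ys)
product-inv {h} = cong h ∘ product-↭

-- The direction favours `Y`: more copies of the first value at which the counts differ put a sorted
-- sequence earlier.
FirstDifference : List (ℕ × ℕ) → List (ℕ × ℕ) → Set
FirstDifference Y Z = ∃ λ q →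
  (∀ v → v < q → multiplicity v Y ≡ multiplicity v Z) × multiplicity q Z < multiplicity q Y

-- acc holds the leading pairs on which Y and Z agree; products of weights
-- commute, so moving a pair there changes no multiplicity. At the first
-- differing pair all later weights exceed w and cannot contribute to it.
firstDifference : ∀ Y Z acc → map proj₁ Y ≡ map proj₁ Z → map proj₂ Y ↭ map proj₂ Z →
  AllPairs _<_ (map proj₁ Y) → AllPairs _≥_ (map proj₂ Y) →
  Weights>1 Y → Weights>1 Z → Weights>1 acc →
  Y ≡ Z ⊎ FirstDifference (Y ++ acc) (Z ++ acc)
firstDifference [] [] acc _ _ _ _ _ _ _ = inj₁ refl
firstDifference ((w , a) ∷ Y) ((w′ , b) ∷ Z) acc weights perm (w<s ∷ inc) (≤a ∷ dec) (1<w ∷ wY) (_ ∷ wZ) wacc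
  with refl , weights′ ← ∷-injective weights with a ≟ b
... | yes refl with firstDifference Y Z ((w , a) ∷ acc) weights′ (drop-∷ perm) inc dec wY wZ (1<w ∷ wacc)
...   | inj₁ refl = inj₁ refl
...   | inj₂ (q , below , at) = inj₂ (q ,
          (λ v v<q → ≡.trans (move v Y) (≡.trans (below v v<q) (sym (move v Z)))) ,
          ≡.subst₂ _<_ (sym (move q Z)) (sym (move q Y)) at)
  where
  move : ∀ v X → multiplicity v ((w , a) ∷ X ++ acc) ≡ multiplicity v (X ++ (w , a) ∷ acc)
  move v X = S-resp-↭ (product-inv {δ v}) (↭-sym (shift (w , a) X acc))
firstDifference ((w , a) ∷ Y) ((w , b) ∷ Z) acc weights perm (w<s ∷ inc) (≤a ∷ dec) (1<w ∷ wY) (_ ∷ wZ) wacc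
    | no a≢b = inj₂ (w ,
          (λ v v<w → ≡.trans (small a v<w w<Y wY) (sym (small b v<w w<Z wZ))) ,
          ≡.subst₂ _<_ (sym (atHead w<Z wZ)) (sym (atHead w<Y wY)) (+-monoʳ-< (multiplicity w acc) b<a))
  where
  w<Y : All ((w <_) ∘ proj₁) Y
  w<Y = All.map⁻ w<s

  w<Z : All ((w <_) ∘ proj₁) Z
  w<Z = All.map⁻ (subst (All (w <_)) weights′ w<s)

  -- `b` is one of the exponents that `Y` still has to place, and `a` is the largest of these.
  b<a : b < a
  b<a = ≤∧≢⇒< (All.lookup (≤-refl ∷ ≤a) (∈-resp-↭ (↭-sym perm) (here refl))) (a≢b ∘ sym)

  small : ∀ {v X} c → v < w → All ((w <_) ∘ proj₁) X → Weights>1 X →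
          multiplicity v ((w , c) ∷ X ++ acc) ≡ multiplicity v acc
  small c v<w w<X wX = multiplicity-++ {Y = (w , c) ∷ _} (v<w ∷ All.map (<-trans v<w) w<X) (1<w ∷ wX) wacc

  atHead : ∀ {c X} → All ((w <_) ∘ proj₁) X → Weights>1 X →
           multiplicity w ((w , c) ∷ X ++ acc) ≡ multiplicity w acc + c
  atHead {c} w<X wX = ≡.trans (multiplicity-head 1<w (All.++⁺ wX wacc))
    (cong (_+ c) (multiplicity-++ w<X wX wacc))

-- Divisors

unique-↭ : {A : Set} {xs ys : List A} → Unique xs → Unique ys →
           (∀ {x} → x ∈ₗ xs → x ∈ₗ ys) → (∀ {x} → x ∈ₗ ys → x ∈ₗ xs) → xs ↭ ys
unique-↭ uxs uys xs⊆ys ys⊆xs = ∼bag⇒↭ (unique∧set⇒bag uxs uys (mk⇔ xs⊆ys ys⊆xs))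

prime>1 : ∀ {p} → Prime p → 1 < p
prime>1 {p} pr = nonTrivial⇒n>1 p {{prime⇒nonTrivial pr}}

prime∣prime : ∀ {p q} → Prime p → Prime q → p ∣ q → p ≡ q
prime∣prime p-prime q-prime p∣q with prime⇒irreducible q-prime p∣q
... | inj₁ refl = contradiction p-prime ¬prime[1]
... | inj₂ p≡q  = p≡q

prime∣^ : ∀ {p} m r → Prime p → p ∣ m ^ r → p ∣ m
prime∣^ m zero    pr p∣1 = contradiction (subst Prime (∣1⇒≡1 p∣1) pr) ¬prime[1]
prime∣^ m (suc r) pr p∣ with euclidsLemma m (m ^ r) pr p∣
... | inj₁ p∣m  = p∣m
... | inj₂ p∣mʳ = prime∣^ m r pr p∣mʳ

∤⇒coprime : ∀ {p d} → Prime p → ¬ p ∣ d → Coprime d p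
∤⇒coprime pr p∤d (c∣d , c∣p) with prime⇒irreducible pr c∣p
... | inj₁ c≡1  = c≡1
... | inj₂ refl = contradiction c∣d p∤d

∣p^r*n⇒∣n : ∀ {p d} r n → Prime p → ¬ p ∣ d → d ∣ p ^ r * n → d ∣ n
∣p^r*n⇒∣n         zero    n pr p∤d d∣ = subst (_ ∣_) (*-identityˡ n) d∣
∣p^r*n⇒∣n {p} {d} (suc r) n pr p∤d d∣ = ∣p^r*n⇒∣n r n pr p∤d
  (coprime-divisor (∤⇒coprime pr p∤d) (subst (d ∣_) (*-assoc p (p ^ r) n) d∣))

-- The multiples of the members of `ds` by the powers of `p` up to `p ^ r`, in Horner form: each
-- level costs one multiplication by `p`, so sums and divisibility go by induction on `r`.
timesPowers : ℕ → ℕ → List ℕ → List ℕ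
timesPowers p zero    ds = ds
timesPowers p (suc r) ds = ds ++ map (p *_) (timesPowers p r ds)

sumOver-timesPowers-invariant : ∀ {p} {g : ℕ → ℕ} → (∀ x → g (p * x) ≡ g x) → ∀ r ds →
  sumOver g (timesPowers p r ds) ≡ suc r * sumOver g ds
sumOver-timesPowers-invariant inv zero ds = sym (+-identityʳ _)
sumOver-timesPowers-invariant {p} {g} inv (suc r) ds = begin
  sumOver g (ds ++ map (p *_) (timesPowers p r ds))
    ≡⟨ sumOver-++ g ds _ ⟩
  sumOver g ds + sumOver g (map (p *_) (timesPowers p r ds))
    ≡⟨ cong (sumOver g ds +_) (≡.trans (sumOver-map g (p *_) (timesPowers p r ds)) (sumOver-cong inv (timesPowers p r ds))) ⟩
  sumOver g ds + sumOver g (timesPowers p r ds)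
    ≡⟨ cong (sumOver g ds +_) (sumOver-timesPowers-invariant inv r ds) ⟩
  suc (suc r) * sumOver g ds ∎
  where open ≡-Reasoning

-- Only the first factor `p` changes the summand, from `g` to `g′`; further factors leave `g′`
-- alone. The `r` positive exponents therefore contribute equally, which is the origin of the
-- coefficients in the theorem.
sumOver-timesPowers : ∀ {p} {g g′ : ℕ → ℕ} → (∀ x → g (p * x) ≡ g′ x) → (∀ x → g′ (p * x) ≡ g′ x) →
  ∀ r ds → sumOver g (timesPowers p r ds) ≡ sumOver g ds + r * sumOver g′ ds
sumOver-timesPowers first inv zero ds = sym (+-identityʳ _)
sumOver-timesPowers {p} {g} {g′} first inv (suc r) ds = ≡.trans (sumOver-++ g ds _) (cong (sumOver g ds +_)
  (≡.trans (sumOver-map g (p *_) (timesPowers p r ds)) (≡.trans (sumOver-cong first (timesPowers p r ds))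
    (sumOver-timesPowers-invariant inv r ds))))

timesPowers-sound : ∀ {p n ds} r → (∀ {d} → d ∈ₗ ds → d ∣ n) →
                    ∀ {d} → d ∈ₗ timesPowers p r ds → d ∣ p ^ r * n
timesPowers-sound {n = n} zero sound d∈ = subst (_ ∣_) (sym (*-identityˡ n)) (sound d∈)
timesPowers-sound {p} {n} {ds} (suc r) sound d∈ with ∈-++⁻ ds d∈
... | inj₁ d∈ds = ∣-trans (sound d∈ds) (n∣m*n (p ^ suc r))
... | inj₂ d∈pE with e , e∈ , refl ← ∈-map⁻ (p *_) d∈pE =
      subst (p * e ∣_) (sym (*-assoc p (p ^ r) n)) (*-monoʳ-∣ p (timesPowers-sound r sound e∈))

timesPowers-complete : ∀ {p n ds} r → Prime p → (∀ {d} → d ∣ n → d ∈ₗ ds) →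
                       ∀ {d} → d ∣ p ^ r * n → d ∈ₗ timesPowers p r ds
timesPowers-complete {n = n} zero pr complete d∣ = complete (subst (_ ∣_) (*-identityˡ n) d∣)
timesPowers-complete {p} {n} {ds} (suc r) pr complete {d} d∣ with p ∣? d
... | no p∤d = ∈-++⁺ˡ (complete (∣p^r*n⇒∣n (suc r) n pr p∤d d∣))
... | yes (divides-refl e) = subst (_∈ₗ timesPowers p (suc r) ds) (*-comm p e)
        (∈-++⁺ʳ ds (∈-map⁺ (p *_) (timesPowers-complete r pr complete
          (*-cancelˡ-∣ p {{prime⇒nonZero pr}}
            (≡.subst₂ _∣_ (*-comm e p) (*-assoc p (p ^ r) n) d∣)))))

timesPowers-unique : ∀ {p ds} r → Prime p → All (λ d → ¬ p ∣ d) ds → Unique ds → Unique (timesPowers p r ds)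
timesPowers-unique zero    pr p∤ u = u
timesPowers-unique {p} {ds} (suc r) pr p∤ u = Unique.++⁺ u
  (Unique.map⁺ (*-cancelˡ-≡ _ _ p {{prime⇒nonZero pr}}) (timesPowers-unique r pr p∤ u))
  λ (d∈ds , d∈pE) → let e , _ , eq = ∈-map⁻ (p *_) d∈pE in
    All.lookup p∤ d∈ds (subst (p ∣_) (sym eq) (m∣m*n e))

divisor>1? : ∀ n d → Dec (1 < d × d ∣ n)
divisor>1? n d = (1 <? d) ×-dec (d ∣? n)

∈-divisors>1⁻ : ∀ n {d} → d ∈ₗ divisors>1 n → 1 < d × d ∣ n
∈-divisors>1⁻ n d∈ = proj₂ (∈-filter⁻ (divisor>1? n) {xs = upTo (suc n)} d∈)

∈-divisors>1⁺ : ∀ n .{{_ : NonZero n}} {d} → 1 < d → d ∣ n → d ∈ₗ divisors>1 n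
∈-divisors>1⁺ n 1<d d∣n = ∈-filter⁺ (divisor>1? n) (∈-upTo⁺ (s≤s (∣⇒≤ d∣n))) (1<d , d∣n)

divisors>1-unique : ∀ n → Unique (divisors>1 n)
divisors>1-unique n = Unique.filter⁺ (divisor>1? n) (Unique.upTo⁺ (suc n))

-- Prime supports and the enumeration of divisors

module _ {A : Set} (p : A → ℕ) where

  Distinct : List A → Set
  Distinct = AllPairs (λ a b → p a ≢ p b)

  module _ {W : Set} (w : A → W) where

    -- When `w` gives the assigned primes, the product of this list is the label of the divisor `d`.
    support : List A → ℕ → List W
    support as d = map w (filter (λ a → p a ∣? d) as)

    support-∣ : ∀ {a} as {d} → p a ∣ d → support (a ∷ as) d ≡ w a ∷ support as d
    support-∣ {a} as {d} pa∣d = cong (map w) (filter-accept (λ a → p a ∣? d) {x = a} {xs = as} pa∣d)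

    support-∤ : ∀ {a} as {d} → ¬ p a ∣ d → support (a ∷ as) d ≡ support as d
    support-∤ {a} as {d} pa∤d = cong (map w) (filter-reject (λ a → p a ∣? d) {x = a} {xs = as} pa∤d)

    support-*ˡ : (∀ a → Prime (p a)) → ∀ {q as} → Prime q → All (λ a → q ≢ p a) as →
                 ∀ d → support as (q * d) ≡ support as d
    support-*ˡ p-prime q-prime [] d = refl
    support-*ˡ p-prime {q} {a ∷ as} q-prime (q≢ ∷ q≢s) d with p a ∣? d
    ... | yes pa∣d = ≡.trans (support-∣ as (∣-trans pa∣d (n∣m*n q)))
            (cong (w a ∷_) (support-*ˡ p-prime q-prime q≢s d))
    ... | no pa∤d = ≡.trans (support-∤ as pa∤qd) (support-*ˡ p-prime q-prime q≢s d)
      where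
      pa∤qd : ¬ p a ∣ q * d
      pa∤qd pa∣qd with euclidsLemma q d (p-prime a) pa∣qd
      ... | inj₁ pa∣q = q≢ (sym (prime∣prime (p-prime a) q-prime pa∣q))
      ... | inj₂ pa∣d = pa∤d pa∣d

module _ {A : Set} (p r : A → ℕ) where

  -- The index type is abstract because two are used: `Fin k` in its given order, and pairs of an
  -- assigned prime and an index in the order of a covering.
  primePowerProduct : List A → ℕ
  primePowerProduct as = product (map (λ a → p a ^ r a) as)

  divisorsOf : List A → List ℕ
  divisorsOf []       = 1 ∷ []
  divisorsOf (a ∷ as) = timesPowers (p a) (r a) (divisorsOf as)

  module _ (p-prime : ∀ a → Prime (p a)) where

    prime∤primePowerProduct : ∀ {q as} → Prime q → All (λ a → q ≢ p a) as → ¬ q ∣ primePowerProduct as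
    prime∤primePowerProduct q-prime [] q∣1 = ¬prime[1] (subst Prime (∣1⇒≡1 q∣1) q-prime)
    prime∤primePowerProduct {as = a ∷ as} q-prime (q≢ ∷ q≢s) q∣ with euclidsLemma (p a ^ r a) _ q-prime q∣
    ... | inj₁ q∣pʳ = q≢ (prime∣prime q-prime (p-prime a) (prime∣^ (p a) (r a) q-prime q∣pʳ))
    ... | inj₂ q∣as = prime∤primePowerProduct q-prime q≢s q∣as

    primePowerProduct≢0 : ∀ as → NonZero (primePowerProduct as)
    primePowerProduct≢0 as = product≢0 (All.map⁺ (All.universal (λ a → m^n≢0 (p a) (r a) {{prime⇒nonZero (p-prime a)}}) as))

    sharedPrime : ∀ {d} as → d ∣ primePowerProduct as → d ≢ 1 → Any (λ a → p a ∣ d) as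
    sharedPrime []       d∣ d≢1 = contradiction (∣1⇒≡1 d∣) d≢1
    sharedPrime {d} (a ∷ as) d∣ d≢1 with p a ∣? d
    ... | yes p∣d = here p∣d
    ... | no p∤d  = there (sharedPrime as (∣p^r*n⇒∣n (r a) _ (p-prime a) p∤d d∣) d≢1)

    divisorsOf-sound : ∀ as {d} → d ∈ₗ divisorsOf as → d ∣ primePowerProduct as
    divisorsOf-sound []       (here refl) = ∣-refl
    divisorsOf-sound (a ∷ as) d∈ = timesPowers-sound (r a) (divisorsOf-sound as) d∈

    divisorsOf-complete : ∀ as {d} → d ∣ primePowerProduct as → d ∈ₗ divisorsOf as
    divisorsOf-complete []       d∣1 = here (∣1⇒≡1 d∣1)
    divisorsOf-complete (a ∷ as) d∣  = timesPowers-complete (r a) (p-prime a) (divisorsOf-complete as) d∣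

    p∤divisorsOf : ∀ {a as} → All (λ b → p a ≢ p b) as → All (λ d → ¬ p a ∣ d) (divisorsOf as)
    p∤divisorsOf {a} {as} pa≢ = All.tabulate λ d∈ pa∣d →
      prime∤primePowerProduct (p-prime a) pa≢ (∣-trans pa∣d (divisorsOf-sound as d∈))

    divisorsOf-unique : ∀ {as} → Distinct p as → Unique (divisorsOf as)
    divisorsOf-unique []            = [] ∷ []
    divisorsOf-unique {a ∷ as} (pa≢ ∷ distinct) =
      timesPowers-unique (r a) (p-prime a) (p∤divisorsOf pa≢) (divisorsOf-unique distinct)

    -- The enumeration by exponents starts from 1, which is not a vertex and has to be added to the
    -- list of vertices.
    divisors-↭ : ∀ {as} → Distinct p as → 1 ∷ divisors>1 (primePowerProduct as) ↭ divisorsOf as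
    divisors-↭ {as} distinct = unique-↭
      (All.tabulate (λ d∈ → <⇒≢ (proj₁ (∈-divisors>1⁻ n d∈))) ∷ divisors>1-unique n)
      (divisorsOf-unique distinct)
      (λ { (here refl) → divisorsOf-complete as (1∣ _)
         ; (there d∈) → divisorsOf-complete as (proj₂ (∈-divisors>1⁻ n d∈)) })
      (λ {d} d∈ → from d (divisorsOf-sound as d∈))
      where
      n = primePowerProduct as
      instance _ = primePowerProduct≢0 as

      from : ∀ d → d ∣ n → d ∈ₗ 1 ∷ divisors>1 n
      from 0 0∣n = contradiction (0∣⇒≡0 0∣n) (≢-nonZero⁻¹ n)
      from 1 _   = here refl
      from (suc (suc d)) d∣n = there (∈-divisors>1⁺ n (s≤s z<s) d∣n)

    module _ {W : Set} (w : A → W) where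

      -- At each prime, exponent 0 leaves the support as it is, and each of the `r a` positive
      -- exponents puts `w a` in front; this is exactly the recursion of `S`.
      sumOver-support : ∀ (h : List W → ℕ) {as} → Distinct p as →
        sumOver (h ∘ support p w as) (divisorsOf as) ≡ S h (map (λ a → w a , r a) as)
      sumOver-support h [] = +-identityʳ _
      sumOver-support h {a ∷ as} (pa≢ ∷ distinct) = begin
        sumOver (h ∘ support p w (a ∷ as)) (timesPowers (p a) (r a) ds)
          ≡⟨ sumOver-timesPowers {g′ = h ∘ (w a ∷_) ∘ support p w as}
               (λ x → cong h (≡.trans (support-∣ p w as (m∣m*n x))
                 (cong (w a ∷_) (support-*ˡ p w p-prime (p-prime a) pa≢ x))))
               (λ x → cong (h ∘ (w a ∷_)) (support-*ˡ p w p-prime (p-prime a) pa≢ x))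
               (r a) ds ⟩
        sumOver (h ∘ support p w (a ∷ as)) ds + r a * sumOver (h ∘ (w a ∷_) ∘ support p w as) ds
          ≡⟨ cong₂ (λ s t → s + r a * t)
               (≡.trans (cong sum (map-cong-local
                          (All.map (λ pa∤ → cong h (support-∤ p w as pa∤)) (p∤divisorsOf pa≢))))
                        (sumOver-support h distinct))
               (sumOver-support (h ∘ (w a ∷_)) distinct) ⟩
        S h (map (λ a → w a , r a) (a ∷ as)) ∎
        where
        open ≡-Reasoning
        ds = divisorsOf as

-- Primes and polynomials

nthPrime-prime : ∀ j → Prime (nthPrime j)
nthPrime-prime zero    = prime[2]
nthPrime-prime (suc j) = proj₂ (proj₁ (nextPrime-minimum (nthPrime j)))

nthPrime-<-suc : ∀ j → nthPrime j < nthPrime (suc j)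
nthPrime-<-suc j = proj₁ (proj₁ (nextPrime-minimum (nthPrime j)))

nthPrime-mono-< : ∀ {i j} → i < j → nthPrime i < nthPrime j
nthPrime-mono-< {i} {suc j} i<1+j with m<1+n⇒m<n∨m≡n i<1+j
... | inj₁ i<j  = <-trans (nthPrime-mono-< i<j) (nthPrime-<-suc j)
... | inj₂ refl = nthPrime-<-suc j

nthPrime-injective : ∀ {i j} → nthPrime i ≡ nthPrime j → i ≡ j
nthPrime-injective {i} {j} eq with <-cmp i j
... | tri< i<j _ _ = contradiction eq (<⇒≢ (nthPrime-mono-< i<j))
... | tri≈ _ i≡j _ = i≡j
... | tri> _ _ j<i = contradiction (sym eq) (<⇒≢ (nthPrime-mono-< j<i))

n<nthPrime : ∀ j → j < nthPrime j
n<nthPrime zero    = z<s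
n<nthPrime (suc j) = ≤-<-trans (n<nthPrime j) (nthPrime-<-suc j)

firstPrimes-allFin : ∀ k → firstPrimes k ≡ map (nthPrime ∘ toℕ) (allFin k)
firstPrimes-allFin k = ≡.trans (map-upTo nthPrime k) (≡.trans (go nthPrime k) (sym (map-tabulate id (nthPrime ∘ toℕ))))
  where
  go : (f : ℕ → ℕ) → ∀ k → applyUpTo f k ≡ tabulate {n = k} (f ∘ toℕ)
  go f zero    = refl
  go f (suc k) = cong (f 0 ∷_) (go (f ∘ suc) k)

coefficient-⊕ : ∀ P Q μ → coefficient (P ⊕ Q) μ ≡ coefficient P μ + coefficient Q μ
coefficient-⊕ P Q μ = begin
  sum (map proj₁ (filter sel? (P ++ Q)))                          ≡⟨ cong (sum ∘ map proj₁) (filter-++ sel? P Q) ⟩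
  sum (map proj₁ (filter sel? P ++ filter sel? Q))                ≡⟨ sumOver-++ proj₁ (filter sel? P) (filter sel? Q) ⟩
  coefficient P μ + coefficient Q μ                               ∎
  where
  open ≡-Reasoning
  sel? = λ (term : ℕ × Monomial) → proj₂ term ↭? μ

coefficient-sumₚ : ∀ Ps μ → coefficient (sumₚ Ps) μ ≡ sumOver (λ P → coefficient P μ) Ps
coefficient-sumₚ []       μ = refl
coefficient-sumₚ (P ∷ Ps) μ = ≡.trans (coefficient-⊕ P (sumₚ Ps) μ) (cong (coefficient P μ +_) (coefficient-sumₚ Ps μ))

isMonomial : Monomial → Monomial → ℕ
isMonomial μ ν = if does (ν ↭? μ) then 1 else 0

isMonomial-resp-↭ : ∀ μ {ν ν′} → ν ↭ ν′ → isMonomial μ ν ≡ isMonomial μ ν′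
isMonomial-resp-↭ μ {ν} {ν′} ν↭ν′ = cong (λ b → if b then 1 else 0)
  (does-⇔ (mk⇔ (↭-trans (↭-sym ν↭ν′)) (↭-trans ν↭ν′)) (ν ↭? μ) (ν′ ↭? μ))

coefficient-term : ∀ c ν μ → coefficient ((c , ν) ∷ []) μ ≡ c * isMonomial μ ν
coefficient-term c ν μ = go (ν ↭? μ)
  where
  sel? = λ (term : ℕ × Monomial) → proj₂ term ↭? μ

  go : Dec (ν ↭ μ) → coefficient ((c , ν) ∷ []) μ ≡ c * isMonomial μ ν
  go (yes ν↭μ) = ≡.trans (cong (sum ∘ map proj₁) (filter-accept sel? {x = c , ν} {xs = []} ν↭μ))
    (≡.trans (≡.trans (+-identityʳ c) (sym (*-identityʳ c)))
      (cong (λ b → c * (if b then 1 else 0)) (sym (dec-true (ν ↭? μ) ν↭μ))))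
  go (no ν↭̸μ) = ≡.trans (cong (sum ∘ map proj₁) (filter-reject sel? {x = c , ν} {xs = []} ν↭̸μ))
    (≡.trans (sym (*-zeroʳ c)) (cong (λ b → c * (if b then 1 else 0)) (sym (dec-false (ν ↭? μ) ν↭̸μ))))

productₚ-X : ∀ js → productₚ (map X js) ≡ (1 , js) ∷ []
productₚ-X []       = refl
productₚ-X (j ∷ js) rewrite productₚ-X js = refl

-- Euclid's lemma shows that trial division finds no foreign index, and `j < nthPrime j ≤ l` that
-- the search range misses none. The search lists the indices in increasing order, hence only a
-- permutation.
primeIndices-↭ : ∀ {js} → Unique js → let l = product (map nthPrime js) in
                 filter (λ j → nthPrime j ∣? l) (upTo l) ↭ js
primeIndices-↭ {js} unique = unique-↭
  (Unique.filter⁺ (λ j → nthPrime j ∣? l) (Unique.upTo⁺ l)) unique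
  (λ j∈ → from (proj₂ (∈-filter⁻ (λ j → nthPrime j ∣? l) {xs = upTo l} j∈)))
  (λ {j} j∈ → let q∣l = ∈⇒∣product (∈-map⁺ nthPrime j∈) in
     ∈-filter⁺ (λ j → nthPrime j ∣? l) (∈-upTo⁺ (<-≤-trans (n<nthPrime j) (∣⇒≤ q∣l))) q∣l)
  where
  l = product (map nthPrime js)
  primes : All Prime (map nthPrime js)
  primes = All.map⁺ (All.universal nthPrime-prime js)
  instance _ = productOfPrimes≢0 primes

  from : ∀ {j} → nthPrime j ∣ l → j ∈ₗ js
  from {j} q∣l with i , i∈ , eq ← ∈-map⁻ nthPrime (factorisationHasAllPrimeFactors (nthPrime-prime j) q∣l primes) =
    subst (_∈ₗ js) (sym (nthPrime-injective eq)) i∈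

coefficient-monomial : ∀ {js} → Unique js → ∀ μ →
  coefficient (monomial (product (map nthPrime js))) μ ≡ isMonomial μ js
coefficient-monomial {js} unique μ = begin
  coefficient (monomial l) μ         ≡⟨ cong (λ P → coefficient P μ) (productₚ-X js′) ⟩
  coefficient ((1 , js′) ∷ []) μ     ≡⟨ coefficient-term 1 js′ μ ⟩
  1 * isMonomial μ js′               ≡⟨ *-identityˡ _ ⟩
  isMonomial μ js′                   ≡⟨ isMonomial-resp-↭ μ (primeIndices-↭ unique) ⟩
  isMonomial μ js                    ∎
  where
  open ≡-Reasoning
  l = product (map nthPrime js)
  js′ = filter (λ j → nthPrime j ∣? l) (upTo l)

coefficient-const⊗X : ∀ c js μ → coefficient (const c ⊗ productₚ (map X js)) μ ≡ c * isMonomial μ js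
coefficient-const⊗X c js μ rewrite productₚ-X js =
  ≡.trans (coefficient-term (c * 1) js μ) (cong (_* isMonomial μ js) (*-identityʳ c))

elements-⊥ : ∀ k → elements (⊥ {k}) ≡ []
elements-⊥ k = filter-none (_∈? ⊥) (All.universal (λ _ → ∉⊥) (allFin k))

-- `S` includes the empty choice while the theorem sums over nonempty sets; the split isolates the
-- constant 1.
allSubsets-↭ : ∀ k → allSubsets k ↭ ⊥ ∷ filter nonempty? (allSubsets k)
allSubsets-↭ k = unique-↭ (allSubsets-unique k)
  (All.tabulate (λ { I∈ refl → let i , i∈ = proj₂ (∈-filter⁻ nonempty? {xs = allSubsets k} I∈) in ∉⊥ i∈ })
    ∷ Unique.filter⁺ nonempty? (allSubsets-unique k))
  (λ {I} _ → to I)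
  (λ {I} _ → allSubsets-complete I)
  where
  to : ∀ I → I ∈ₗ ⊥ ∷ filter nonempty? (allSubsets k)
  to I with nonempty? I
  ... | yes ne   = there (∈-filter⁺ nonempty? (allSubsets-complete I) ne)
  ... | no empty = here (Empty-unique empty)

module _ (k : ℕ) (r : Fin k → ℕ) where

  optimalWeights : List (ℕ × ℕ)
  optimalWeights = map (λ i → nthPrime (toℕ i) , r i) (allFin k)

  subsetTerm : Subset k → Polynomial
  subsetTerm I = const (product (map r (elements I))) ⊗ productₚ (map (λ i → X (toℕ i)) (elements I))

  coefficient-subsetTerm : ∀ I μ →
    coefficient (subsetTerm I) μ ≡ product (map r (elements I)) * isMonomial μ (map toℕ (elements I))
  coefficient-subsetTerm I μ = ≡.trans
    (cong (λ Xs → coefficient (const c ⊗ productₚ Xs) μ) (map-∘ (elements I)))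
    (coefficient-const⊗X c (map toℕ (elements I)) μ)
    where c = product (map r (elements I))

  S-optimalWeights : ∀ μ → S ((λ l → coefficient (monomial l) μ) ∘ product) optimalWeights ≡
    coefficient (const 1) μ + coefficient (sumₚ (map subsetTerm (filter nonempty? (allSubsets k)))) μ
  S-optimalWeights μ = begin
    S (h ∘ product) optimalWeights
      ≡⟨ S-subsets (h ∘ product) k (nthPrime ∘ toℕ) r ⟩
    sumOver (λ I → product (map r (elements I)) * h (product (map (nthPrime ∘ toℕ) (elements I)))) (allSubsets k)
      ≡⟨ sumOver-cong pointwise (allSubsets k) ⟩
    sumOver c (allSubsets k)
      ≡⟨ sum-↭ (map⁺ c (allSubsets-↭ k)) ⟩
    c ⊥ + sumOver c (filter nonempty? (allSubsets k))
      ≡⟨ cong₂ _+_ (≡.trans (coefficient-subsetTerm ⊥ μ) (≡.trans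
             (cong (λ is → product (map r is) * isMonomial μ (map toℕ is)) (elements-⊥ k))
             (sym (coefficient-term 1 [] μ))))
           (≡.sym (≡.trans (coefficient-sumₚ (map subsetTerm (filter nonempty? (allSubsets k))) μ)
             (sumOver-map _ subsetTerm (filter nonempty? (allSubsets k))))) ⟩
    coefficient (const 1) μ + coefficient (sumₚ (map subsetTerm (filter nonempty? (allSubsets k)))) μ ∎
    where
    open ≡-Reasoning
    h = λ l → coefficient (monomial l) μ
    c = λ I → coefficient (subsetTerm I) μ

    pointwise : ∀ I → product (map r (elements I)) * h (product (map (nthPrime ∘ toℕ) (elements I))) ≡ c I
    pointwise I = ≡.trans
      (cong (product (map r (elements I)) *_) (≡.trans
        (cong (h ∘ product) (map-∘ (elements I)))
        (coefficient-monomial (Unique.map⁺ toℕ-injective (Unique.filter⁺ (_∈? I) (Unique.allFin⁺ k))) μ)))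
      (sym (coefficient-subsetTerm I μ))

-- Coverings of the divisor graph

-- Pigeonhole: each entry of `xs` is removed from `ys` in turn, and the length bound leaves nothing
-- over.
unique∧⊆⇒↭ : {xs ys : List A} → Unique xs → (∀ {x} → x ∈ₗ xs → x ∈ₗ ys) → length ys ≤ length xs → xs ↭ ys
unique∧⊆⇒↭ {xs = []}     {[]} _         _  _   = ↭-refl
unique∧⊆⇒↭ {xs = x ∷ xs} (x∉ ∷ unique) xs⊆ len with ∈-∃++ (xs⊆ (here refl))
... | as , bs , refl = ↭-trans
  (prep x (unique∧⊆⇒↭ unique rest⊆ (s≤s⁻¹ (subst (_≤ suc (length xs)) (↭-length (shift x as bs)) len))))
  (↭-sym (shift x as bs))
  where
  rest⊆ : ∀ {y} → y ∈ₗ xs → y ∈ₗ as ++ bs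
  rest⊆ y∈ with ∈-resp-↭ (shift x as bs) (xs⊆ (there y∈))
  ... | here refl = contradiction refl (All.lookup x∉ y∈)
  ... | there y∈′ = y∈′

lookup-injective : {xs : List A} → Unique xs → ∀ {i j} → lookup xs i ≡ lookup xs j → i ≡ j
lookup-injective (_ ∷ _)  {fzero}  {fzero}  _  = refl
lookup-injective (x∉ ∷ _) {fzero}  {fsuc j} eq = contradiction eq (All.lookup x∉ (∈-lookup j))
lookup-injective (x∉ ∷ _) {fsuc i} {fzero}  eq = contradiction (sym eq) (All.lookup x∉ (∈-lookup i))
lookup-injective (_ ∷ u)  {fsuc i} {fsuc j} eq = cong fsuc (lookup-injective u eq)

map-lookup-allFin : (xs : List A) → map (lookup xs) (allFin (length xs)) ≡ xs
map-lookup-allFin xs = ≡.trans (map-tabulate id (lookup xs)) (tabulate-lookup xs)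

map-proj₁-zip : (xs : List A) (ys : List B) → length xs ≡ length ys → map proj₁ (zip xs ys) ≡ xs
map-proj₁-zip []       []       _   = refl
map-proj₁-zip (x ∷ xs) (y ∷ ys) len = cong (x ∷_) (map-proj₁-zip xs ys (suc-injective len))

map-proj₂-zip : (xs : List A) (ys : List B) → length xs ≡ length ys → map proj₂ (zip xs ys) ≡ ys
map-proj₂-zip []       []       _   = refl
map-proj₂-zip (x ∷ xs) (y ∷ ys) len = cong (y ∷_) (map-proj₂-zip xs ys (suc-injective len))

∈-tabulate⁺ : ∀ {m} {P : Fin m → Set} (P? : ∀ v → Dec (P v)) {v} → P v → v ∈ Vec.tabulate (does ∘ P?)
∈-tabulate⁺ P? {v} pv = Vec.lookup⇒[]= v _ (≡.trans (Vec.lookup∘tabulate (does ∘ P?) v) (dec-true (P? v) pv))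

∈-tabulate⁻ : ∀ {m} {P : Fin m → Set} (P? : ∀ v → Dec (P v)) {v} → v ∈ Vec.tabulate (does ∘ P?) → P v
∈-tabulate⁻ P? {v} v∈ with P? v | ≡.trans (sym (Vec.lookup∘tabulate (does ∘ P?) v)) (Vec.[]=⇒lookup v∈)
... | yes pv | _ = pv

≤ₗₑₓ-antisym : ∀ {xs ys} → xs ≤ₗₑₓ ys → ys ≤ₗₑₓ xs → xs ≡ ys
≤ₗₑₓ-antisym xs≤ys ys≤xs = Pointwise-≡⇒≡ (≤-antisymmetric sym ≤-antisym xs≤ys ys≤xs)

sumOver-↭ : (h : A → ℕ) {xs ys : List A} → xs ↭ ys → sumOver h xs ≡ sumOver h ys
sumOver-↭ h xs↭ys = sum-↭ (map⁺ h xs↭ys)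

-- Labels and a labelling that attains `σ`

module _ (G : Graph) (R : List (Subset (Graph.order G))) (ps : List ℕ) where

  cliqueProduct : Fin (Graph.order G) → ℕ
  cliqueProduct v = product (map proj₁ (filter (λ pC → v ∈? proj₂ pC) (zip ps R)))

  label-isolated : ∀ {v} → Isolated G v → label G R ps v ≡ 1
  label-isolated {v} iso = cong (if_then 1 else cliqueProduct v) (dec-true (isolated? G v) iso)

  label-nonisolated : ∀ {v} → ¬ Isolated G v → label G R ps v ≡ cliqueProduct v
  label-nonisolated {v} ¬iso = cong (if_then 1 else cliqueProduct v) (dec-false (isolated? G v) ¬iso)

sumOver-labels : ∀ G R ps h → sumOver h (labels G R ps) ≡ sumOver (h ∘ label G R ps) (allFin (Graph.order G))
sumOver-labels G R ps h = ≡.trans (sumOver-↭ h (sort-↭ (map (label G R ps) (allFin _))))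
  (sumOver-map h (label G R ps) (allFin _))

-- The two nested minima unfolded. In `least` the clique list stays fixed and only the assignment
-- varies; any assignment of primes to the same cliques can be expressed in this way.
record OptimalLabelling (G : Graph) : Set where
  field
    cliques    : List (Subset (Graph.order G))
    primes     : List ℕ
    covering   : IsMinimumCovering G cliques
    assignment : IsAssignment G primes
    σ≡labels   : σ G ≡ labels G cliques primes
    least      : ∀ ps → IsAssignment G ps → σ G ≤ₗₑₓ labels G cliques ps

optimalLabelling : ∀ G → OptimalLabelling G
optimalLabelling G =
  let (R , covering , σ≡σ[R]) , _ = σ-lexLeast G
      (ps , assignment , σ[R]≡labels) , least = σ[]-lexLeast G R
  in record
    { cliques    = R
    ; primes     = ps
    ; covering   = covering
    ; assignment = assignment
    ; σ≡labels   = ≡.trans σ≡σ[R] σ[R]≡labels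
    ; least      = λ qs qs-assignment → subst (_≤ₗₑₓ labels G R qs) (sym σ≡σ[R]) (least qs qs-assignment)
    }

-- Holds by computation: the only index tried is 0, and 2 does not divide 1.
coefficient-monomial-1 : ∀ μ → coefficient (monomial 1) μ ≡ coefficient (const 1) μ
coefficient-monomial-1 μ = refl

coefficient-F : ∀ G μ → coefficient (F G) μ ≡ sumOver (λ l → coefficient (monomial l) μ) (σ G)
coefficient-F G μ = ≡.trans (coefficient-sumₚ (map monomial (σ G)) μ) (sumOver-map (λ P → coefficient P μ) monomial (σ G))

-- Vertices as divisors, and the prime case

module DivisorGraph (n : ℕ) .{{_ : NonZero n}} where

  G : Graph
  G = divisorGraph n

  open Graph G using (order; Adj)

  divisor : Fin order → ℕ
  divisor = lookup (divisors>1 n)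

  divisor>1 : ∀ v → 1 < divisor v
  divisor>1 v = proj₁ (∈-divisors>1⁻ n (∈-lookup v))

  divisor∣n : ∀ v → divisor v ∣ n
  divisor∣n v = proj₂ (∈-divisors>1⁻ n (∈-lookup v))

  divisor-injective : ∀ {u v} → divisor u ≡ divisor v → u ≡ v
  divisor-injective = lookup-injective (divisors>1-unique n)

  vertex : ∀ {d} → 1 < d → d ∣ n → Fin order
  vertex 1<d d∣n = Any.index (∈-divisors>1⁺ n 1<d d∣n)

  divisor-vertex : ∀ {d} (1<d : 1 < d) (d∣n : d ∣ n) → divisor (vertex 1<d d∣n) ≡ d
  divisor-vertex 1<d d∣n = sym (Any.lookup-index (∈-divisors>1⁺ n 1<d d∣n))

  sumOver-divisor : (h : ℕ → ℕ) → sumOver (h ∘ divisor) (allFin order) ≡ sumOver h (divisors>1 n)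
  sumOver-divisor h = ≡.trans (sym (sumOver-map h divisor (allFin order)))
    (cong (sumOver h) (map-lookup-allFin (divisors>1 n)))

  module _ (n-prime : Prime n) where

    divisor≡n : ∀ v → divisor v ≡ n
    divisor≡n v with prime⇒irreducible n-prime (divisor∣n v)
    ... | inj₁ d≡1 = contradiction (sym d≡1) (<⇒≢ (divisor>1 v))
    ... | inj₂ d≡n = d≡n

    isolated : ∀ v → Isolated G v
    isolated v u (v≢u , _) = v≢u (divisor-injective (≡.trans (divisor≡n v) (sym (divisor≡n u))))

    divisors>1-prime : divisors>1 n ↭ n ∷ []
    divisors>1-prime = unique-↭ (divisors>1-unique n) ([] ∷ [])
      (λ d∈ → here (≡.trans (Any.lookup-index d∈) (divisor≡n (Any.index d∈))))
      (λ { (here refl) → ∈-divisors>1⁺ n (prime>1 n-prime) ∣-refl })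

    -- The single vertex is isolated, so its label is 1 whichever covering and assignment attain
    -- `σ`.
    sumOver-σ-prime : ∀ h → sumOver h (σ G) ≡ h 1
    sumOver-σ-prime h = begin
      sumOver h (σ G)                             ≡⟨ cong (sumOver h) σ≡labels ⟩
      sumOver h (labels G cliques primes)         ≡⟨ sumOver-labels G cliques primes h ⟩
      sumOver (h ∘ label G cliques primes) (allFin order)
        ≡⟨ sumOver-cong (λ v → cong h (label-isolated G cliques primes (isolated v))) (allFin order) ⟩
      sumOver (λ _ → h 1) (allFin order)          ≡⟨ sumOver-divisor (λ _ → h 1) ⟩
      sumOver (λ _ → h 1) (divisors>1 n)          ≡⟨ sumOver-↭ (λ _ → h 1) divisors>1-prime ⟩
      h 1 + 0                                     ≡⟨ +-identityʳ (h 1) ⟩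
      h 1                                         ∎
      where
      open ≡-Reasoning
      open OptimalLabelling (optimalLabelling G)

    F-prime : F G ≈ const 1
    F-prime μ = ≡.trans (coefficient-F G μ) (≡.trans (sumOver-σ-prime (λ l → coefficient (monomial l) μ))
      (coefficient-monomial-1 μ))

-- Minimum coverings by cliques of multiples

module PrimePowers {k : ℕ} (p r : Fin k → ℕ) (p-prime : ∀ i → Prime (p i)) (p-injective : Injective _≡_ _≡_ p)
                   (r≥1 : ∀ i → 1 ≤ r i) where

  n : ℕ
  n = primePowerProduct p r (allFin k)

  instance
    n≢0 : NonZero n
    n≢0 = primePowerProduct≢0 p r p-prime (allFin k)

  open DivisorGraph n
  open Graph G using (order; Adj)

  p∣n : ∀ i → p i ∣ n
  p∣n i = ∣-trans (p∣pʳ (r≥1 i)) (∈⇒∣product (∈-map⁺ (λ i → p i ^ r i) (∈-allFin i)))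
    where
    p∣pʳ : ∀ {e} → 1 ≤ e → p i ∣ p i ^ e
    p∣pʳ {suc e} _ = m∣m*n (p i ^ e)

  p∣p⇒≡ : ∀ {i j} → p i ∣ p j → i ≡ j
  p∣p⇒≡ {i} {j} pi∣pj = p-injective (prime∣prime (p-prime i) (p-prime j) pi∣pj)

  primeVertex : Fin k → Fin order
  primeVertex i = vertex (prime>1 (p-prime i)) (p∣n i)

  divisor-primeVertex : ∀ i → divisor (primeVertex i) ≡ p i
  divisor-primeVertex i = divisor-vertex (prime>1 (p-prime i)) (p∣n i)

  p∣primeVertex : ∀ i → p i ∣ divisor (primeVertex i)
  p∣primeVertex i = ∣-reflexive (sym (divisor-primeVertex i))

  primeVertex-∣⇒≡ : ∀ {i j} → p i ∣ divisor (primeVertex j) → i ≡ j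
  primeVertex-∣⇒≡ {i} {j} pi∣ = p∣p⇒≡ (subst (p i ∣_) (divisor-primeVertex j) pi∣)

  someCommonPrime : ∀ {d} → 1 < d → d ∣ n → Any (λ i → p i ∣ d) (allFin k)
  someCommonPrime 1<d d∣n = sharedPrime p r p-prime (allFin k) d∣n (<⇒≢ 1<d ∘ sym)

  adjacent : ∀ {i u v} → p i ∣ divisor u → p i ∣ divisor v → u ≢ v → Adj u v
  adjacent {i} {u} {v} pi∣u pi∣v u≢v = u≢v , <-≤-trans (prime>1 (p-prime i))
    (∣⇒≤ {{≢-nonZero (gcd[m,n]≢0 (divisor u) (divisor v) (inj₁ (m<n⇒n≢0 (divisor>1 u))))}}
      (gcd-greatest pi∣u pi∣v))

  adjacent-primeVertex : ∀ {i v} → Adj (primeVertex i) v → p i ∣ divisor v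
  adjacent-primeVertex {i} {v} (_ , 1<g)
    with prime⇒irreducible (p-prime i) (subst (gcd (divisor (primeVertex i)) (divisor v) ∣_)
           (divisor-primeVertex i) (gcd[m,n]∣m (divisor (primeVertex i)) (divisor v)))
  ... | inj₁ g≡1 = contradiction (sym g≡1) (<⇒≢ 1<g)
  ... | inj₂ g≡p = subst (_∣ divisor v) g≡p (gcd[m,n]∣n (divisor (primeVertex i)) (divisor v))

  multiple? : ∀ i v → Dec (p i ∣ divisor v)
  multiple? i v = p i ∣? divisor v

  multiples : Fin k → Subset order
  multiples i = Vec.tabulate (does ∘ multiple? i)

  ∈-multiples⁺ : ∀ {i v} → p i ∣ divisor v → v ∈ multiples i
  ∈-multiples⁺ {i} = ∈-tabulate⁺ (multiple? i)

  ∈-multiples⁻ : ∀ {i v} → v ∈ multiples i → p i ∣ divisor v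
  ∈-multiples⁻ {i} = ∈-tabulate⁻ (multiple? i)

  -- A prime dividing the gcd of two adjacent vertices puts both into one clique. The cliques are
  -- distinct because `primeVertex i` lies in the clique of `i` alone.
  multiples-covering : IsTotalCliqueCovering G (map multiples (allFin k))
  multiples-covering = mkCovering
    (Unique.map⁺ (λ {i} {j} eq → sym (primeVertex-∣⇒≡ (∈-multiples⁻
      (subst (primeVertex i ∈_) eq (∈-multiples⁺ (p∣primeVertex i)))))) (Unique.allFin⁺ k))
    (All.map⁺ (All.universal (λ i u v u∈ v∈ → adjacent {i} (∈-multiples⁻ u∈) (∈-multiples⁻ v∈)) (allFin k)))
    (λ v → Any.map⁺ (Any.map ∈-multiples⁺ (someCommonPrime (divisor>1 v) (divisor∣n v))))
    (λ u v (_ , 1<g) → Any.map⁺ (Any.map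
      (λ pi∣g → ∈-multiples⁺ (∣-trans pi∣g (gcd[m,n]∣m (divisor u) (divisor v))) ,
                ∈-multiples⁺ (∣-trans pi∣g (gcd[m,n]∣n (divisor u) (divisor v))))
      (someCommonPrime 1<g (∣-trans (gcd[m,n]∣m (divisor u) (divisor v)) (divisor∣n u)))))

  θₜ≤k : θₜ G ≤ k
  θₜ≤k = proj₂ (θₜ-minimum G) k (_ , multiples-covering , ≡.trans (length-map multiples (allFin k)) (length-tabulate id))

  -- The bound `length R ≤ k` stands in for minimality: it makes the `k` distinct cliques chosen at
  -- the primes exhaust `R`.
  covering-multiples : ∀ {R} → IsTotalCliqueCovering G R → length R ≤ k → map multiples (allFin k) ↭ R
  covering-multiples {R} (mkCovering _ cliques coversVertex coversEdge) len =
    subst (_↭ R) (map-cong clique≡multiples (allFin k)) cliques↭R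
    where
    clique : Fin k → Subset order
    clique i = proj₁ (find (coversVertex (primeVertex i)))

    clique∈R : ∀ i → clique i ∈ₗ R
    clique∈R i = proj₁ (proj₂ (find (coversVertex (primeVertex i))))

    primeVertex∈ : ∀ i → primeVertex i ∈ clique i
    primeVertex∈ i = proj₂ (proj₂ (find (coversVertex (primeVertex i))))

    ∈-clique⇒∣ : ∀ {i u} → u ∈ clique i → p i ∣ divisor u
    ∈-clique⇒∣ {i} {u} u∈ with primeVertex i Fin.≟ u
    ... | yes refl = p∣primeVertex i
    ... | no v≢u   = adjacent-primeVertex (All.lookup cliques (clique∈R i) _ u (primeVertex∈ i) u∈ v≢u)

    clique-injective : ∀ {i j} → clique i ≡ clique j → i ≡ j
    clique-injective {i} {j} eq = sym (primeVertex-∣⇒≡ (∈-clique⇒∣ (subst (primeVertex i ∈_) eq (primeVertex∈ i))))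

    cliques↭R : map clique (allFin k) ↭ R
    cliques↭R = unique∧⊆⇒↭ (Unique.map⁺ clique-injective (Unique.allFin⁺ k))
      (λ C∈ → let i , _ , C≡ = ∈-map⁻ clique C∈ in subst (_∈ₗ R) (sym C≡) (clique∈R i))
      (subst (length R ≤_) (sym (≡.trans (length-map clique (allFin k)) (length-tabulate id))) len)

    -- The clique that covers an edge at `primeVertex i` need not be the chosen one a priori. It is
    -- the clique chosen at some `j`, and containing `primeVertex i` forces `j ≡ i`.
    ∈-clique : ∀ {i u C} → C ∈ₗ R → primeVertex i ∈ C → u ∈ C → u ∈ clique i
    ∈-clique {i} {u} C∈R v∈C u∈C =
      let j , _ , C≡ = ∈-map⁻ clique (∈-resp-↭ (↭-sym cliques↭R) C∈R)
          j≡i = primeVertex-∣⇒≡ {j} {i} (∈-clique⇒∣ (subst (primeVertex i ∈_) C≡ v∈C))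
      in subst (u ∈_) (≡.trans C≡ (cong clique j≡i)) u∈C

    ∣⇒∈-clique : ∀ {i u} → p i ∣ divisor u → u ∈ clique i
    ∣⇒∈-clique {i} {u} pi∣u with primeVertex i Fin.≟ u
    ... | yes refl = primeVertex∈ i
    ... | no v≢u   =
      let C , C∈R , v∈C , u∈C = find (coversEdge (primeVertex i) u (adjacent (p∣primeVertex i) pi∣u v≢u))
      in ∈-clique C∈R v∈C u∈C

    clique≡multiples : ∀ i → clique i ≡ multiples i
    clique≡multiples i = ⊆-antisym (∈-multiples⁺ ∘ ∈-clique⇒∣) (∣⇒∈-clique ∘ ∈-multiples⁻)

  -- The non-prime case: labels as divisor supports

  module NonPrime (i₀ : Fin k) (n-nonprime : ¬ Prime n) where

    -- A proper divisor is adjacent to the vertex `n`, and `n` is adjacent to its prime factor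
    -- `p i₀`, which differs from `n` because `n` is not prime.
    nonisolated : ∀ v → ¬ Isolated G v
    nonisolated v isolated with divisor v ≟ n
    ... | yes d≡n = isolated (primeVertex i₀) (adjacent
            (subst (p i₀ ∣_) (sym d≡n) (p∣n i₀)) (p∣primeVertex i₀)
            λ v≡ → n-nonprime (subst Prime
              (≡.trans (sym (divisor-primeVertex i₀)) (≡.trans (cong divisor (sym v≡)) d≡n)) (p-prime i₀)))
    ... | no d≢n with i , pi∣d ← Any.satisfied (someCommonPrime (divisor>1 v) (divisor∣n v)) =
          isolated top (adjacent pi∣d (subst (p i ∣_) (sym divisor-top) (p∣n i))
            λ v≡ → d≢n (≡.trans (cong divisor v≡) divisor-top))
      where
      n>1 : 1 < n
      n>1 = <-≤-trans (divisor>1 v) (∣⇒≤ (divisor∣n v))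

      top : Fin order
      top = vertex n>1 ∣-refl

      divisor-top : divisor top ≡ n
      divisor-top = divisor-vertex n>1 ∣-refl

    isolatedVertices≡[] : isolatedVertices G ≡ []
    isolatedVertices≡[] = filter-none (isolated? G) (All.universal nonisolated (allFin order))

    -- Without isolated vertices `R` is the whole covering. The upper bound on `θₜ` alone already
    -- forces `R` to be a reordering of the `k` cliques of multiples, and the equality `θₜ G ≡ k` is
    -- then read off from its length.
    minimumCovering : ∀ {R} → IsMinimumCovering G R → θₜ G ≡ k × ∃ λ is → R ≡ map multiples is × allFin k ↭ is
    minimumCovering {R} (cov , len) = θₜ≡k , indices
      where
      S≡R : isolatedSingletons G ++ R ≡ R
      S≡R = cong (λ vs → map ⁅_⁆ vs ++ R) isolatedVertices≡[]

      cov′ : IsTotalCliqueCovering G R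
      cov′ = subst (IsTotalCliqueCovering G) S≡R cov

      len′ : length R ≡ θₜ G
      len′ = ≡.trans (cong length (sym S≡R)) len

      len≤k : length R ≤ k
      len≤k = ≤-trans (≤-reflexive len′) θₜ≤k

      indices : ∃ λ is → R ≡ map multiples is × allFin k ↭ is
      indices = ↭-map-inv multiples (covering-multiples cov′ len≤k)

      θₜ≡k : θₜ G ≡ k
      θₜ≡k = ≡.trans (sym len′) (≡.trans (sym (↭-length (covering-multiples cov′ len≤k)))
        (≡.trans (length-map multiples (allFin k)) (length-tabulate id)))

    k′≡k : θₜ G ≡ k → k′ G ≡ k
    k′≡k θ≡k = cong₂ _∸_ θ≡k (cong length isolatedVertices≡[])

    -- One list of pairs records both the order of the cliques and the assignment, so a reordering
    -- moves each prime together with its clique.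
    labelling : List (ℕ × Fin k) → List ℕ
    labelling B = labels G (map multiples (map proj₂ B)) (map proj₁ B)

    length-labelling : ∀ B → length (labelling B) ≡ order
    length-labelling B = ≡.trans (↭-length (sort-↭ (map ℓ (allFin order))))
      (≡.trans (length-map ℓ (allFin order)) (length-tabulate id))
      where ℓ = label G (map multiples (map proj₂ B)) (map proj₁ B)

    record OptimalAssignment : Set where
      field
        assigned    : List (ℕ × Fin k)
        indices     : allFin k ↭ map proj₂ assigned
        primes      : map proj₁ assigned ↭ firstPrimes k
        σ≡labelling : σ G ≡ labelling assigned
        least       : ∀ C → map proj₂ C ≡ map proj₂ assigned → map proj₁ C ↭ firstPrimes k → σ G ≤ₗₑₓ labelling C

    optimalAssignment : OptimalAssignment
    optimalAssignment = record
      { assigned    = zip ps is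
      ; indices     = subst (allFin k ↭_) (sym is≡) allFin↭is
      ; primes      = subst (_↭ firstPrimes k) (sym ps≡) ps↭
      ; σ≡labelling = ≡.trans σ≡labels (cong₂ (labels G) (≡.trans R≡ (cong (map multiples) (sym is≡))) (sym ps≡))
      ; least       = λ C indices primes → subst (λ R → σ G ≤ₗₑₓ labels G R (map proj₁ C))
          (≡.trans R≡ (cong (map multiples) (sym (≡.trans indices is≡))))
          (least (map proj₁ C) (subst (λ l → map proj₁ C ↭ firstPrimes l) (sym k′≡k₀) primes))
      }
      where
      open OptimalLabelling (optimalLabelling G) renaming (cliques to R; primes to ps)

      is : List (Fin k)
      is = proj₁ (proj₂ (minimumCovering covering))

      R≡ : R ≡ map multiples is
      R≡ = proj₁ (proj₂ (proj₂ (minimumCovering covering)))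

      allFin↭is : allFin k ↭ is
      allFin↭is = proj₂ (proj₂ (proj₂ (minimumCovering covering)))

      k′≡k₀ : k′ G ≡ k
      k′≡k₀ = k′≡k (proj₁ (minimumCovering covering))

      ps↭ : ps ↭ firstPrimes k
      ps↭ = subst (λ l → ps ↭ firstPrimes l) k′≡k₀ assignment

      len : length ps ≡ length is
      len = begin
        length ps                ≡⟨ ↭-length ps↭ ⟩
        length (firstPrimes k)   ≡⟨ length-map nthPrime (upTo k) ⟩
        length (upTo k)          ≡⟨ length-upTo k ⟩
        k                        ≡⟨ length-tabulate id ⟨
        length (allFin k)        ≡⟨ ↭-length allFin↭is ⟩
        length is                ∎
        where open ≡-Reasoning

      ps≡ : map proj₁ (zip ps is) ≡ ps
      ps≡ = map-proj₁-zip ps is len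

      is≡ : map proj₂ (zip ps is) ≡ is
      is≡ = map-proj₂-zip ps is len

    module _ (B : List (ℕ × Fin k)) (indices : allFin k ↭ map proj₂ B) where

      private
        R  = map multiples (map proj₂ B)
        ps = map proj₁ B

        p′ r′ : ℕ × Fin k → ℕ
        p′ = p ∘ proj₂
        r′ = r ∘ proj₂

      cliqueProduct-support : ∀ v → cliqueProduct G R ps v ≡
        product (support p′ proj₁ B (divisor v))
      cliqueProduct-support v = cong product (go B)
        where
        sel? : (pC : ℕ × Subset order) → Dec (v ∈ proj₂ pC)
        sel? pC = v ∈? proj₂ pC

        go : ∀ B → map proj₁ (filter sel? (zip (map proj₁ B) (map multiples (map proj₂ B)))) ≡
                   support p′ proj₁ B (divisor v)
        go [] = refl
        go ((q , i) ∷ B) = cases (multiple? i v)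
          where
          tail = zip (map proj₁ B) (map multiples (map proj₂ B))

          cases : Dec (p i ∣ divisor v) → map proj₁ (filter sel? ((q , multiples i) ∷ tail)) ≡
                  support p′ proj₁ ((q , i) ∷ B) (divisor v)
          cases (yes pi∣d) = ≡.trans
            (cong (map proj₁) (filter-accept sel? {x = q , multiples i} {xs = tail} (∈-multiples⁺ pi∣d)))
            (≡.trans (cong (q ∷_) (go B))
              (sym (support-∣ p′ proj₁ {a = q , i} B pi∣d)))
          cases (no pi∤d) = ≡.trans
            (cong (map proj₁) (filter-reject sel? {x = q , multiples i} {xs = tail} (pi∤d ∘ ∈-multiples⁻)))
            (≡.trans (go B) (sym (support-∤ p′ proj₁ {a = q , i} B pi∤d)))

      distinct : Distinct p′ B
      distinct = AllPairs.map (λ i≢j → i≢j ∘ p-injective)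
        (AllPairs.map⁻ (PermSetoid.Unique-resp-↭ (≡.setoid _) (↭⇒↭ₛ indices) (Unique.allFin⁺ k)))

      divisors↭ : 1 ∷ divisors>1 n ↭ divisorsOf p′ r′ B
      divisors↭ = subst (λ m → 1 ∷ divisors>1 m ↭ divisorsOf p′ r′ B) n′≡n
        (divisors-↭ p′ r′ (p-prime ∘ proj₂) distinct)
        where
        n′≡n : primePowerProduct p′ r′ B ≡ n
        n′≡n = ≡.trans (cong product (map-∘ B))
          (product-↭ (map⁺ (λ i → p i ^ r i) (↭-sym indices)))

      -- The divisor 1 is not a vertex; it contributes the leading h 1.
      sumOver-labels-S : ∀ h → h 1 + sumOver h (labels G R ps) ≡ S (h ∘ product) (map (map₂ r) B)
      sumOver-labels-S h = begin
        h 1 + sumOver h (labels G R ps)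
          ≡⟨ cong (h 1 +_) (sumOver-labels G R ps h) ⟩
        h 1 + sumOver (h ∘ label G R ps) (allFin order)
          ≡⟨ cong (h 1 +_) (sumOver-cong (λ v → cong h
               (≡.trans (label-nonisolated G R ps (nonisolated v)) (cliqueProduct-support v))) (allFin order)) ⟩
        h 1 + sumOver (g ∘ divisor) (allFin order)
          ≡⟨ cong₂ (λ s t → h (product s) + t) (sym support-1) (sumOver-divisor g) ⟩
        sumOver g (1 ∷ divisors>1 n)
          ≡⟨ sumOver-↭ g divisors↭ ⟩
        sumOver g (divisorsOf p′ r′ B)
          ≡⟨ sumOver-support p′ r′ (p-prime ∘ proj₂) proj₁ (h ∘ product) distinct ⟩
        S (h ∘ product) (map (map₂ r) B) ∎
        where
        open ≡-Reasoning
        g = h ∘ product ∘ support p′ proj₁ B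

        support-1 : support p′ proj₁ B 1 ≡ []
        support-1 = cong (map proj₁) (filter-none (λ b → p′ b ∣? 1)
          (All.universal (λ (_ , i) pi∣1 → <⇒≢ (prime>1 (p-prime i)) (sym (∣1⇒≡1 pi∣1))) B))

    -- The optimal assignment has non-increasing exponents

    module _ (r-decreasing : ∀ i j → i ≤ᶠ j → r j ≤ r i) where

      private
        Y = optimalWeights k r

        proj₁-Y : map proj₁ Y ≡ firstPrimes k
        proj₁-Y = ≡.trans (sym (map-∘ (allFin k))) (sym (firstPrimes-allFin k))

        proj₂-Y : map proj₂ Y ≡ map r (allFin k)
        proj₂-Y = sym (map-∘ (allFin k))

      Weights>1-firstPrimes : ∀ Z → map proj₁ Z ≡ firstPrimes k → Weights>1 Z
      Weights>1-firstPrimes Z eq = All.map⁻ (subst (All (1 <_)) (sym eq)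
        (All.map⁺ (All.universal (prime>1 ∘ nthPrime-prime) (upTo k))))

      optimal : ∀ Z → map proj₁ Z ≡ firstPrimes k → map r (allFin k) ↭ map proj₂ Z →
                Y ≡ Z ⊎ FirstDifference Y Z
      optimal Z weights mults
        with firstDifference Y Z [] (≡.trans proj₁-Y (sym weights)) (subst (_↭ map proj₂ Z) (sym proj₂-Y) mults)
               (subst (AllPairs _<_) (sym (≡.trans proj₁-Y (≡.trans (firstPrimes-allFin k) (map-tabulate id _))))
                 (AllPairs.tabulate⁺-< nthPrime-mono-<))
               (subst (AllPairs _≥_) (sym (≡.trans proj₂-Y (map-tabulate id r)))
                 (AllPairs.tabulate⁺-< (λ i<j → r-decreasing _ _ (<⇒≤ i<j))))
               (Weights>1-firstPrimes Y proj₁-Y) (Weights>1-firstPrimes Z weights) []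
      ... | inj₁ Y≡Z  = inj₁ Y≡Z
      ... | inj₂ diff = inj₂ (≡.subst₂ FirstDifference (++-identityʳ Y) (++-identityʳ Z) diff)

      -- The comparison uses the indicators `δ v` only, but it settles the sequence `σ G` or its
      -- pair list, so the formula follows for every `h`.
      sumOver-σ : ∀ h → h 1 + sumOver h (σ G) ≡ S (h ∘ product) Y
      sumOver-σ h = go (optimal Z (≡.trans (sym (map-∘ B₁)) (sym primes≡))
        (subst (map r (allFin k) ↭_) (≡.trans (sym (map-∘ B₁)) (map-∘ B₁))
          (map⁺ r (↭-trans indices (map⁺ proj₂ B₀↭B₁)))))
        where
        open OptimalAssignment optimalAssignment renaming (assigned to B₀)

        -- The optimal assignment is listed by increasing prime, the order in which `Y` is written.
        reordered : ∃ λ B₁ → firstPrimes k ≡ map proj₁ B₁ × B₀ ↭ B₁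
        reordered = ↭-map-inv proj₁ primes

        B₁ : List (ℕ × Fin k)
        B₁ = proj₁ reordered

        primes≡ : firstPrimes k ≡ map proj₁ B₁
        primes≡ = proj₁ (proj₂ reordered)

        B₀↭B₁ : B₀ ↭ B₁
        B₀↭B₁ = proj₂ (proj₂ reordered)

        -- The assignment that the theorem predicts, with the prime `nthPrime (toℕ i)` given to the
        -- clique of `p i`; `competitor` lists it in the clique order of `B₀`, as `least` requires.
        C₀ : List (ℕ × Fin k)
        C₀ = map (λ i → nthPrime (toℕ i) , i) (allFin k)

        competitor : ∃ λ C → map proj₂ B₀ ≡ map proj₂ C × C₀ ↭ C
        competitor = ↭-map-inv proj₂
          (subst (_↭ map proj₂ B₀) (≡.trans (sym (map-id (allFin k))) (map-∘ (allFin k))) indices)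

        C : List (ℕ × Fin k)
        C = proj₁ competitor

        indices≡ : map proj₂ B₀ ≡ map proj₂ C
        indices≡ = proj₁ (proj₂ competitor)

        C₀↭C : C₀ ↭ C
        C₀↭C = proj₂ (proj₂ competitor)

        Z : List (ℕ × ℕ)
        Z = map (map₂ r) B₁

        σ-S : ∀ h → h 1 + sumOver h (σ G) ≡ S (h ∘ product) Z
        σ-S h = ≡.trans (cong (λ xs → h 1 + sumOver h xs) σ≡labelling)
          (≡.trans (sumOver-labels-S B₀ indices h) (S-resp-↭ (product-inv {h}) (map⁺ (map₂ r) B₀↭B₁)))

        C-S : ∀ h → h 1 + sumOver h (labelling C) ≡ S (h ∘ product) Y
        C-S h = ≡.trans (sumOver-labels-S C (subst (allFin k ↭_) indices≡ indices) h)
          (≡.trans (S-resp-↭ (product-inv {h}) (map⁺ (map₂ r) (↭-sym C₀↭C)))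
            (cong (S (h ∘ product)) (sym (map-∘ (allFin k)))))

        primes-C : map proj₁ C ↭ firstPrimes k
        primes-C = ↭-trans (map⁺ proj₁ (↭-sym C₀↭C))
          (↭-reflexive (≡.trans (sym (map-∘ (allFin k))) (sym (firstPrimes-allFin k))))

        -- Both closed forms contain the same surplus `δ v 1` from the divisor 1.
        count-cancel : ∀ v {m l} xs ys → δ v 1 + count v xs ≡ m → δ v 1 + count v ys ≡ l → m ≡ l → count v xs ≡ count v ys
        count-cancel v xs ys refl refl = +-cancelˡ-≡ (δ v 1) _ _

        go : Y ≡ Z ⊎ FirstDifference Y Z → h 1 + sumOver h (σ G) ≡ S (h ∘ product) Y
        go (inj₁ Y≡Z) = ≡.trans (σ-S h) (cong (S (h ∘ product)) (sym Y≡Z))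
        -- `C` has more labels `q` and equally many of each smaller value, so it comes no later than
        -- `σ G`. Minimality then makes the two equal, and the sums over `C` are those of `Y`.
        go (inj₂ (q , below , at)) = ≡.trans (cong (λ xs → h 1 + sumOver h xs) σ≡C) (C-S h)
          where
          C≤σ : labelling C ≤ₗₑₓ σ G
          C≤σ = ≤ₗₑₓ-by-count q (Sorted⇒AllPairs ≤-totalOrder (sort-↗ (map (label G (map multiples (map proj₂ C)) (map proj₁ C)) (allFin order))))
            (≡.trans (length-labelling C) (sym (≡.trans (cong length σ≡labelling) (length-labelling B₀))))
            (λ v v<q → count-cancel v (labelling C) (σ G) (C-S (δ v)) (σ-S (δ v)) (below v v<q))
            (+-cancelˡ-< (δ q 1) _ _ (≡.subst₂ _<_ (sym (σ-S (δ q))) (sym (C-S (δ q))) at))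

          σ≡C : σ G ≡ labelling C
          σ≡C = ≤ₗₑₓ-antisym (least C (sym indices≡) primes-C) C≤σ

      F-nonprime : F G ≈ sumₚ (map (subsetTerm k r) (filter nonempty? (allSubsets k)))
      -- The summand cancelled here comes from the divisor 1 on the left and from the empty index
      -- set on the right.
      F-nonprime μ = +-cancelˡ-≡ (coefficient (const 1) μ) _ _ (≡.trans
        (cong₂ _+_ (sym (coefficient-monomial-1 μ)) (coefficient-F G μ))
        (≡.trans (sumOver-σ (λ l → coefficient (monomial l) μ)) (S-optimalWeights k r μ)))

theorem5 : (k : ℕ) → 1 ≤ k →
    (p r : Fin k → ℕ) →
    (∀ i → Prime (p i)) →
    Injective _≡_ _≡_ p →
    (∀ i j → i ≤ᶠ j → r j ≤ r i) →
    (∀ i → 1 ≤ r i) →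
    (n : ℕ) → n ≡ product (map (λ i → p i ^ r i) (allFin k)) →
    (¬ Prime n →
    F (divisorGraph n) ≈
    sumₚ (map (λ I → const (product (map r (elements I))) ⊗ productₚ (map (λ i → X (toℕ i)) (elements I)))
    (filter nonempty? (allSubsets k))))
    × (Prime n → F (divisorGraph n) ≈ const 1)
theorem5 (suc k) _ p r p-prime p-injective r-decreasing r≥1 n refl =
  (λ n-nonprime → NonPrime.F-nonprime fzero n-nonprime r-decreasing) ,
  DivisorGraph.F-prime n
  where open PrimePowers p r p-prime p-injective r≥1 using (module NonPrime; n≢0)
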